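{- Let $Q=[0,1]\times[0,1]$ and let $\mu$ be two-dimensional Lebesgue measure on $Q$. For $\lambda\in[0,1]$ let $R^0(\lambda)=\{(x,y)\in Q : y\le\lambda\}$ and $R^1(\lambda)=\{(x,y)\in Q : y\ge 1-\lambda\}$, and let $\mathcal{R}^0=\{R^0(\lambda) : 0\le\lambda\le 1\}$. Define on $\mathcal{R}^0$ $$R^0(a)\oplus R^0(b)=R^0\big(\mu(R^0(a)\cup R^1(b))\big),\qquad R^0(a)\odot R^0(b)=R^0\big(\mu(R^0(a)\cap R^1(b))\big),$$ $$\neg R^0(a)=R^0\big(\mu(Q\setminus R^0(a))\big)=R^0(1-a),$$ and let $0=R^0(0)$, $1=R^0(1)=Q$. Then $(\mathcal{R}^0,\oplus,\neg,0,1)$ and $(\mathcal{R}^0,\odot,\neg,1,0)$ are MV-algebras (in the second, $1$ is the identity element of the monoid operation $\odot$).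
   Context: An MV-algebra is a structure $(A,+,\neg,e,u)$ such that $(A,+,e)$ is a commutative monoid with identity $e$, and for all $x,y\in A$: (i) $\neg(\neg x)=x$; (ii) $u+x=u$; (iii) $x+\neg e=\neg e$; (iv) $\neg(\neg x+y)+y=\neg(\neg y+x)+x$. -}

module Defs where

open import Level using (0ℓ; _⊔_)
open import Algebra.Bundles using (CommutativeRing)
open import Algebra.Core using (Op₁; Op₂)
import Algebra.Definitions as AlgDefs
import Algebra.Properties.CommutativeMonoid.Sum as FiniteSum
import Algebra.Properties.Ring as RingProps
open import Algebra.Structures using (IsCommutativeMonoid)
open import Data.Fin.Base using (toℕ)
open import Data.Nat.Base using (ℕ; zero; suc)
open import Data.Product.Base using (Σ; Σ-syntax; ∃; ∃-syntax; _×_; _,_; proj₁; proj₂)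
open import Data.Sum.Base using (inj₁; inj₂)
open import Function.Base using (_∘_)
open import Relation.Binary.Core using (Rel)
open import Relation.Binary.Structures using (IsTotalOrder)
open import Relation.Nullary.Negation.Core using (¬_)
open import Relation.Unary using (Pred; Satisfiable; _∈_; _∪_; _∩_; _∖_; ∁; _≐_)

record IsMVAlgebra {a ℓ} {A : Set a} (_≈_ : Rel A ℓ)
                   (_+_ : Op₂ A) (∼_ : Op₁ A) (e u : A) : Set (a ⊔ ℓ) where
  open AlgDefs _≈_
  field
    isCommutativeMonoid : IsCommutativeMonoid _≈_ _+_ e
    ∼-cong              : Congruent₁ ∼_
    ∼-involutive        : Involutive ∼_
    u-zeroˡ             : LeftZero u _+_
    ∼e-zeroʳ            : RightZero (∼ e) _+_
    łukasiewicz         : ∀ x y → ((∼ ((∼ x) + y)) + y) ≈ ((∼ ((∼ y) + x)) + x)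

module Bounds {A : Set} (_≤_ : Rel A 0ℓ) where

  IsUpperBound IsLowerBound IsSupremum IsInfimum : Pred A 0ℓ → A → Set
  IsUpperBound P b = ∀ x → x ∈ P → x ≤ b
  IsLowerBound P b = ∀ x → x ∈ P → b ≤ x
  IsSupremum   P s = IsUpperBound P s × (∀ b → IsUpperBound P b → s ≤ b)
  IsInfimum    P i = IsLowerBound P i × (∀ b → IsLowerBound P b → b ≤ i)

-- The real numbers, characterised (uniquely up to isomorphism, classically)
-- as a Dedekind-complete totally ordered field.  Equality is a setoid
-- equality so that, for instance, Cauchy sequences of rationals qualify.
record CompleteOrderedField : Set₁ where
  infix 4 _≤_
  field
    commutativeRing : CommutativeRing 0ℓ 0ℓ
  open CommutativeRing commutativeRing public
  field
    0≉1          : ¬ (0# ≈ 1#)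
    inverse      : ∀ x → ¬ (x ≈ 0#) → ∃[ y ] (x * y ≈ 1#)
    _≤_          : Rel Carrier 0ℓ
    isTotalOrder : IsTotalOrder _≈_ _≤_
    +-monoˡ-≤    : ∀ z {x y} → x ≤ y → x + z ≤ y + z
    *-nonneg     : ∀ {x y} → 0# ≤ x → 0# ≤ y → 0# ≤ x * y
  open Bounds _≤_ public
  field
    complete     : (P : Pred Carrier 0ℓ) → Satisfiable P → ∃ (IsUpperBound P) →
                   ∃ (IsSupremum P)
  module ≤ = IsTotalOrder isTotalOrder

module UnitSquare (ℝ : CompleteOrderedField) where

  open CompleteOrderedField ℝ
  open FiniteSum +-commutativeMonoid using (sum; sum-replicate-zero)
  open RingProps ring using (-‿distribˡ-*; -‿distribʳ-*; -‿involutive; -0#≈0#)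

  infima : (P : Pred Carrier 0ℓ) → Satisfiable P → ∃ (IsLowerBound P) → ∃ (IsInfimum P)
  infima P (x , x∈P) lb with complete (IsLowerBound P) lb (x , λ b b≤P → b≤P x x∈P)
  ... | i , ub , least = i , (λ y y∈P → least y (λ b b≤P → b≤P y y∈P)) , ub

  0≤1 : 0# ≤ 1#
  0≤1 with ≤.total 0# 1#
  ... | inj₁ 0≤1 = 0≤1
  ... | inj₂ 1≤0 = ≤.≤-respʳ-≈ -1*-1≈1 (*-nonneg 0≤-1 0≤-1)
    where
    0≤-1 : 0# ≤ - 1#
    0≤-1 = ≤.≤-respˡ-≈ (-‿inverseʳ 1#) (≤.≤-respʳ-≈ (+-identityˡ (- 1#)) (+-monoˡ-≤ (- 1#) 1≤0))
    -1*-1≈1 : - 1# * - 1# ≈ 1#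
    -1*-1≈1 = trans (sym (-‿distribˡ-* 1# (- 1#)))
             (trans (-‿cong (*-identityˡ (- 1#))) (-‿involutive 1#))

  I : Set
  I = Σ[ x ∈ Carrier ] (0# ≤ x × x ≤ 1#)

  value : I → Carrier
  value = proj₁

  0ᴵ 1ᴵ : I
  0ᴵ = 0# , ≤.refl , 0≤1
  1ᴵ = 1# , 0≤1 , ≤.refl

  1ᴵ-_ : I → I
  1ᴵ- (a , 0≤a , a≤1) = 1# - a , 0≤1-a , 1-a≤1
    where
    0≤1-a : 0# ≤ 1# - a
    0≤1-a = ≤.≤-respˡ-≈ (-‿inverseʳ a) (+-monoˡ-≤ (- a) a≤1)
    1-a≤1 : 1# - a ≤ 1#
    1-a≤1 = ≤.≤-respˡ-≈ (+-identityˡ (1# - a))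
           (≤.≤-respʳ-≈ (trans (+-comm a (1# - a))
                        (trans (+-assoc 1# (- a) a)
                        (trans (+-congˡ (-‿inverseˡ a)) (+-identityʳ 1#))))
             (+-monoˡ-≤ (1# - a) 0≤a))

  -- Subsets of Q are predicates on this type, so that ∁ E is Q ∖ E.
  Q : Set
  Q = I × I

  record Rectangle : Set where
    field
      left right bottom top : Carrier
      left≤right            : left ≤ right
      bottom≤top            : bottom ≤ top

  open Rectangle

  area : Rectangle → Carrier
  area r = (right r - left r) * (top r - bottom r)

  _∈ᴿ_ : Q → Rectangle → Set
  (x , y) ∈ᴿ r = (left r ≤ value x × value x ≤ right r) ×
                 (bottom r ≤ value y × value y ≤ top r)

  Covers : (ℕ → Rectangle) → Pred Q 0ℓ → Set
  Covers r E = ∀ p → p ∈ E → ∃[ n ] (p ∈ᴿ r n)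

  -- The areas are non-negative, so the series converges exactly when its
  -- partial sums have a supremum, and that supremum is its sum.
  HasTotalArea : (ℕ → Rectangle) → Carrier → Set
  HasTotalArea r = IsSupremum (λ t → ∃[ n ] (t ≈ sum {n} (area ∘ r ∘ toℕ)))

  -- Covers of infinite total area do not affect the infimum below, since
  -- every subset of Q has a cover of finite total area.
  CoverArea : Pred Q 0ℓ → Pred Carrier 0ℓ
  CoverArea E s = ∃[ r ] (Covers r E × HasTotalArea r s)

  CoverArea≥0 : ∀ E → IsLowerBound (CoverArea E) 0#
  CoverArea≥0 E s (r , _ , ub , _) = ub 0# (0 , refl)

  1∈CoverArea : ∀ E → 1# ∈ CoverArea E
  1∈CoverArea E = r , (λ { (x , y) _ → 0 , proj₂ x , proj₂ y }) , ub , least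
    where
    square point : Rectangle
    square = record { left = 0# ; right = 1# ; bottom = 0# ; top = 1#
                    ; left≤right = 0≤1 ; bottom≤top = 0≤1 }
    point  = record { left = 0# ; right = 0# ; bottom = 0# ; top = 0#
                    ; left≤right = ≤.refl ; bottom≤top = ≤.refl }
    r : ℕ → Rectangle
    r zero    = square
    r (suc _) = point
    1-0≈1 : 1# - 0# ≈ 1#
    1-0≈1 = trans (+-congˡ -0#≈0#) (+-identityʳ 1#)
    square≈1 : area square ≈ 1#
    square≈1 = trans (*-cong 1-0≈1 1-0≈1) (*-identityˡ 1#)
    point≈0 : area point ≈ 0#
    point≈0 = trans (*-congʳ (-‿inverseʳ 0#)) (zeroˡ _)
    points≈0 : ∀ n → sum {n} (λ _ → area point) ≈ 0#
    points≈0 zero    = refl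
    points≈0 (suc n) = trans (+-cong point≈0 (points≈0 n)) (+-identityˡ 0#)
    total : ∀ n → sum {suc n} (area ∘ r ∘ toℕ) ≈ 1#
    total n = trans (+-cong square≈1 (points≈0 n)) (+-identityʳ 1#)
    ub : IsUpperBound (λ t → ∃[ n ] (t ≈ sum {n} (area ∘ r ∘ toℕ))) 1#
    ub t (zero  , t≈) = ≤.≤-respˡ-≈ (sym t≈) 0≤1
    ub t (suc n , t≈) = ≤.reflexive (trans t≈ (total n))
    least : ∀ b → IsUpperBound (λ t → ∃[ n ] (t ≈ sum {n} (area ∘ r ∘ toℕ))) b → 1# ≤ b
    least b t≤b = t≤b 1# (1 , sym (total 0))

  -- Lebesgue outer measure of a subset of Q; on the sets satisfying
  -- LebesgueMeasurable it is Lebesgue measure.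
  μ : Pred Q 0ℓ → I
  μ E with infima (CoverArea E) (1# , 1∈CoverArea E) (0# , CoverArea≥0 E)
  ... | m , lb , greatest = m , greatest 0# (CoverArea≥0 E) , lb 1# (1∈CoverArea E)

  -- Carathéodory's criterion.
  LebesgueMeasurable : Pred Q 0ℓ → Set₁
  LebesgueMeasurable E = ∀ A → value (μ A) ≈ value (μ (A ∩ E)) + value (μ (A ∖ E))

  R⁰ R¹ : I → Pred Q 0ℓ
  R⁰ a (x , y) = value y ≤ value a
  R¹ a (x , y) = 1# - value a ≤ value y

  𝓡⁰ : Set₁
  𝓡⁰ = Σ[ S ∈ Pred Q 0ℓ ] ∃[ a ] (S ≐ R⁰ a)

  infix 4 _≈ᴿ_
  _≈ᴿ_ : Rel 𝓡⁰ 0ℓ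
  S ≈ᴿ T = proj₁ S ≐ proj₁ T

  R⁰[_] : I → 𝓡⁰
  R⁰[ a ] = R⁰ a , a , (λ z → z) , (λ z → z)

  infixl 6 _⊕_
  infixl 7 _⊙_
  infix  8 ∼_

  _⊕_ _⊙_ : Op₂ 𝓡⁰
  (_ , a , _) ⊕ (_ , b , _) = R⁰[ μ (R⁰ a ∪ R¹ b) ]
  (_ , a , _) ⊙ (_ , b , _) = R⁰[ μ (R⁰ a ∩ R¹ b) ]

  ∼_ : Op₁ 𝓡⁰
  ∼ (_ , a , _) = R⁰[ μ (∁ (R⁰ a)) ]

  𝟘 𝟙 : 𝓡⁰
  𝟘 = R⁰[ 0ᴵ ]
  𝟙 = R⁰[ 1ᴵ ]

{-# OPTIONS --safe #-}

-- The sets R⁰ a ∪ R¹ b, R⁰ a ∩ R¹ b and Q ∖ R⁰ a have measure min(1, a + b),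
-- max(0, a + b - 1) and 1 - a, so R⁰ a ↦ a identifies the two structures with
-- the standard MV-algebra on [0,1] and its dual.
--
-- Each measure is bounded above by covers with horizontal strips.  By
-- subadditivity the lower bounds follow from the upper bounds for complements
-- and from μ Q ≥ 1.  For the latter, enlarge the rectangles of a cover slightly.
-- Say that a subrectangle of Q is full if the enlarged cover has at least its
-- area inside it.  Fullness is preserved by concatenation and holds for small
-- subrectangles near any point, hence, by Cousin's lemma in each coordinate,
-- for Q.
--
-- Half-planes are measurable because cutting each rectangle of a cover along a
-- horizontal line preserves the total area.
module Submission where

open import Defs
open import Level using (0ℓ)
open import Algebra.Bundles using (CommutativeRing; RawRing)
import Algebra.Construct.NaturalChoice.Max as Max
import Algebra.Construct.NaturalChoice.Min as Min
open import Algebra.Core using (Op₁; Op₂)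
import Algebra.Properties.AbelianGroup as AbelianGroupProps
import Algebra.Properties.CommutativeMonoid.Sum as FiniteSum
import Algebra.Properties.CommutativeSemigroup as CommSemigroupProps
import Algebra.Properties.Ring as RingProps
import Algebra.Properties.Semiring.Mult as Mult
import Algebra.Solver.Ring as RingSolver
open import Algebra.Solver.Ring.AlmostCommutativeRing
  using (_-Raw-AlmostCommutative⟶_; fromCommutativeRing)
open import Algebra.Structures using (IsCommutativeMonoid)
open import Axiom.ExcludedMiddle using (ExcludedMiddle)
open import Data.Fin.Base using (toℕ)
open import Data.Maybe.Base as Maybe using (Maybe)
open import Data.Nat.Base as ℕ using (ℕ; zero; suc; z≤n; s≤s)
import Data.Nat.Properties as ℕ
open import Data.Product.Base using (_×_; _,_; proj₁; proj₂; swap; ∃-syntax)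
open import Data.Product.Properties using (≡-dec)
open import Data.Sum.Base using (inj₁; inj₂; [_,_]′)
open import Function.Base using (_∘_; id)
open import Relation.Binary.Bundles using (TotalOrder)
open import Relation.Binary.Core using (Rel)
open import Relation.Binary.PropositionalEquality.Core as ≡ using (_≡_)
import Relation.Binary.Reasoning.Setoid as SetoidReasoning
open import Relation.Nullary.Decidable.Core using (dec⇒maybe; decidable-stable; toSum)
open import Relation.Nullary.Negation.Core using (¬_; contradiction)
open import Relation.Unary using (Pred; _∈_; _⊆_; _∪_; _∩_; _∖_; ∁; _≐_; U)
open import Relation.Unary.Properties using (≐-refl; ≐-sym; ≐-trans)

-- Ring identities with integer coefficients.

-- The solver needs a coefficient ring in which zero is recognisable.  The pair
-- (m , n) stands for the integer m - n; it is kept reduced so that the normal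
-- forms of the solver are unique.
module IntegerCoefficientSolver (R : CommutativeRing 0ℓ 0ℓ) where
  open CommutativeRing R
  open RingProps ring using (-‿distribˡ-*; -‿distribʳ-*; -‿involutive; -0#≈0#)
  open AbelianGroupProps +-abelianGroup using () renaming (⁻¹-∙-comm to -‿+-comm)
  open CommSemigroupProps +-commutativeSemigroup using (interchange)
  open Mult semiring renaming (_×_ to _·_)
  open SetoidReasoning setoid

  reduce : ℕ × ℕ → ℕ × ℕ
  reduce (suc m , suc n) = reduce (m , n)
  reduce x               = x

  sumᵈ productᵈ : ℕ × ℕ → ℕ × ℕ → ℕ × ℕ
  sumᵈ     (m , n) (p , q) = m ℕ.+ p , n ℕ.+ q
  productᵈ (m , n) (p , q) = m ℕ.* p ℕ.+ n ℕ.* q , m ℕ.* q ℕ.+ n ℕ.* p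

  differences : RawRing 0ℓ 0ℓ
  differences = record
    { Carrier = ℕ × ℕ
    ; _≈_     = _≡_
    ; _+_     = λ x y → reduce (sumᵈ x y)
    ; _*_     = λ x y → reduce (productᵈ x y)
    ; -_      = swap
    ; 0#      = 0 , 0
    ; 1#      = 1 , 0
    }

  [_] : ℕ → Carrier
  [ n ] = n · 1#

  ⟪_⟫ : ℕ × ℕ → Carrier
  ⟪ m , n ⟫ = [ m ] - [ n ]

  reduce-homo : ∀ x → ⟪ reduce x ⟫ ≈ ⟪ x ⟫
  reduce-homo (zero , _)      = refl
  reduce-homo (suc _ , zero)  = refl
  reduce-homo (suc m , suc n) = begin
    ⟪ reduce (m , n) ⟫                ≈⟨ reduce-homo (m , n) ⟩
    [ m ] - [ n ]                     ≈⟨ +-identityˡ _ ⟨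
    0# + ([ m ] - [ n ])              ≈⟨ +-congʳ (-‿inverseʳ 1#) ⟨
    (1# - 1#) + ([ m ] - [ n ])       ≈⟨ interchange _ _ _ _ ⟩
    (1# + [ m ]) + (- 1# - [ n ])     ≈⟨ +-congˡ (-‿+-comm 1# [ n ]) ⟩
    [ suc m ] - [ suc n ]             ∎

  sumᵈ-homo : ∀ x y → ⟪ sumᵈ x y ⟫ ≈ ⟪ x ⟫ + ⟪ y ⟫
  sumᵈ-homo (m , n) (p , q) = begin
    [ m ℕ.+ p ] - [ n ℕ.+ q ]           ≈⟨ +-cong (×-homo-+ 1# m p) (-‿cong (×-homo-+ 1# n q)) ⟩
    ([ m ] + [ p ]) - ([ n ] + [ q ])   ≈⟨ +-congˡ (-‿+-comm [ n ] [ q ]) ⟨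
    ([ m ] + [ p ]) + (- [ n ] - [ q ]) ≈⟨ interchange _ _ _ _ ⟩
    ([ m ] - [ n ]) + ([ p ] - [ q ])   ∎

  productᵈ-homo : ∀ x y → ⟪ productᵈ x y ⟫ ≈ ⟪ x ⟫ * ⟪ y ⟫
  productᵈ-homo (m , n) (p , q) = begin
    [ m ℕ.* p ℕ.+ n ℕ.* q ] - [ m ℕ.* q ℕ.+ n ℕ.* p ]
      ≈⟨ +-cong (homo m p n q) (-‿cong (homo m q n p)) ⟩
    (M * P + N * Q) - (M * Q + N * P)
      ≈⟨ +-cong (+-congˡ (sym -N*-Q)) (sym (-‿+-comm _ _)) ⟩
    (M * P + (- N) * (- Q)) + (- (M * Q) - N * P)
      ≈⟨ +-congˡ (trans (+-comm _ _) (+-cong (-‿distribˡ-* N P) (-‿distribʳ-* M Q))) ⟩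
    (M * P + (- N) * (- Q)) + ((- N) * P + M * (- Q))
      ≈⟨ interchange _ _ _ _ ⟩
    (M * P + (- N) * P) + ((- N) * (- Q) + M * (- Q))
      ≈⟨ +-cong (sym (distribʳ P M (- N))) (trans (+-comm _ _) (sym (distribʳ (- Q) M (- N)))) ⟩
    (M - N) * P + (M - N) * (- Q)
      ≈⟨ distribˡ (M - N) P (- Q) ⟨
    (M - N) * (P - Q) ∎
    where
    M = [ m ]
    N = [ n ]
    P = [ p ]
    Q = [ q ]
    homo : ∀ i j k l → [ i ℕ.* j ℕ.+ k ℕ.* l ] ≈ [ i ] * [ j ] + [ k ] * [ l ]
    homo i j k l = trans (×-homo-+ 1# (i ℕ.* j) (k ℕ.* l)) (+-cong (×1-homo-* i j) (×1-homo-* k l))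
    -N*-Q : (- N) * (- Q) ≈ N * Q
    -N*-Q = trans (sym (-‿distribˡ-* N (- Q)))
           (trans (-‿cong (sym (-‿distribʳ-* N Q))) (-‿involutive (N * Q)))

  swap-homo : ∀ x → ⟪ swap x ⟫ ≈ - ⟪ x ⟫
  swap-homo (m , n) = begin
    [ n ] - [ m ]         ≈⟨ +-comm _ _ ⟩
    - [ m ] + [ n ]       ≈⟨ +-congˡ (-‿involutive [ n ]) ⟨
    - [ m ] - (- [ n ])   ≈⟨ -‿+-comm [ m ] (- [ n ]) ⟩
    - ([ m ] - [ n ])     ∎

  -- Agrees with ⟪_⟫, but makes the solver read its constants as 0# and 1# definitionally.
  ⟦_⟧ : ℕ × ℕ → Carrier
  ⟦ 0 , 0 ⟧ = 0#
  ⟦ 1 , 0 ⟧ = 1#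
  ⟦ m , n ⟧ = ⟪ m , n ⟫

  ⟦⟧≈⟪⟫ : ∀ x → ⟦ x ⟧ ≈ ⟪ x ⟫
  ⟦⟧≈⟪⟫ (0 , 0)               = sym (trans (+-congˡ -0#≈0#) (+-identityʳ 0#))
  ⟦⟧≈⟪⟫ (1 , 0)               = sym (trans (+-congˡ -0#≈0#) (trans (+-identityʳ [ 1 ]) (×-homo-1 1#)))
  ⟦⟧≈⟪⟫ (0 , suc _)           = refl
  ⟦⟧≈⟪⟫ (1 , suc _)           = refl
  ⟦⟧≈⟪⟫ (suc (suc _) , zero)  = refl
  ⟦⟧≈⟪⟫ (suc (suc _) , suc _) = refl

  morphism : differences -Raw-AlmostCommutative⟶ fromCommutativeRing R
  morphism = record
    { ⟦_⟧    = ⟦_⟧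
    ; +-homo = λ x y → trans (reduced (sumᵈ x y))
                      (trans (sumᵈ-homo x y) (+-cong (sym (⟦⟧≈⟪⟫ x)) (sym (⟦⟧≈⟪⟫ y))))
    ; *-homo = λ x y → trans (reduced (productᵈ x y))
                      (trans (productᵈ-homo x y) (*-cong (sym (⟦⟧≈⟪⟫ x)) (sym (⟦⟧≈⟪⟫ y))))
    ; -‿homo = λ x → trans (⟦⟧≈⟪⟫ (swap x)) (trans (swap-homo x) (-‿cong (sym (⟦⟧≈⟪⟫ x))))
    ; 0-homo = refl
    ; 1-homo = refl
    }
    where
    reduced : ∀ x → ⟦ reduce x ⟧ ≈ ⟪ x ⟫
    reduced x = trans (⟦⟧≈⟪⟫ (reduce x)) (reduce-homo x)

  _≟_ : ∀ x y → Maybe (⟦ x ⟧ ≈ ⟦ y ⟧)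
  x ≟ y = Maybe.map (λ { ≡.refl → refl }) (dec⇒maybe (≡-dec ℕ._≟_ ℕ._≟_ x y))

  open RingSolver differences (fromCommutativeRing R) morphism _≟_ public
    using (solve; _:=_; _:+_; _:-_; _:*_; :-_; con; Polynomial)

  :0 :1 : ∀ {n} → Polynomial n
  :0 = con (0 , 0)
  :1 = con (1 , 0)

-- Order arithmetic in a complete ordered field.

module OrderedFieldProperties (ℝ : CompleteOrderedField) where
  open CompleteOrderedField ℝ hiding (zero)
  open UnitSquare ℝ using (0≤1)
  open IntegerCoefficientSolver commutativeRing

  totalOrder : TotalOrder 0ℓ 0ℓ 0ℓ
  totalOrder = record { isTotalOrder = isTotalOrder }

  open Min totalOrder public using (_⊓_; ⊓-sel; x≤y⇒x⊓y≈x; x≤y⇒y⊓x≈x; ⊓-glb; x⊓y≤x; x⊓y≤y; ⊓-mono-≤; ⊓-cong)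
  open Max totalOrder public using (_⊔_; ⊔-lub; x≤x⊔y; x≤y⊔x; ⊔-mono-≤)

  infix 4 _>0
  -- Strict positivity is encoded negatively because `_≤_` is the only order given; totality
  -- recovers nonnegativity from it.
  _>0 : Carrier → Set
  x >0 = ¬ (x ≤ 0#)

  >0⇒≥0 : ∀ {x} → x >0 → 0# ≤ x
  >0⇒≥0 {x} x>0 with ≤.total 0# x
  ... | inj₁ 0≤x = 0≤x
  ... | inj₂ x≤0 = contradiction x≤0 x>0

  ≰⇒≥ : ∀ {x y} → ¬ (x ≤ y) → y ≤ x
  ≰⇒≥ {x} {y} x≰y with ≤.total x y
  ... | inj₁ x≤y = contradiction x≤y x≰y
  ... | inj₂ y≤x = y≤x

  -- An order relation depends only on the difference of its two sides. Linear inequalities thereby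
  -- reduce to ring identities, which the solver proves.
  ≤-from₁ : ∀ {x y a b} → a ≤ b → y - x ≈ b - a → x ≤ y
  ≤-from₁ {x} {y} {a} {b} a≤b eq =
    ≤.≤-respˡ-≈ (solve 2 (λ x a → a :+ (x :- a) := x) refl x a)
   (≤.≤-respʳ-≈ (trans (solve 3 (λ x a b → b :+ (x :- a) := (b :- a) :+ x) refl x a b)
                (trans (+-congʳ (sym eq)) (solve 2 (λ x y → (y :- x) :+ x := y) refl x y)))
     (+-monoˡ-≤ (x - a) a≤b))

  ≤-from₂ : ∀ {x y a b c d} → a ≤ b → c ≤ d → y - x ≈ (b - a) + (d - c) → x ≤ y
  ≤-from₂ {x} {y} {a} {b} {c} {d} a≤b c≤d eq = ≤-from₁ {x} {y} (≤.trans a+c≤b+c b+c≤b+d)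
    (trans eq (solve 4 (λ a b c d → (b :- a) :+ (d :- c) := (b :+ d) :- (a :+ c)) refl a b c d))
    where
    a+c≤b+c : a + c ≤ b + c
    a+c≤b+c = +-monoˡ-≤ c a≤b
    b+c≤b+d : b + c ≤ b + d
    b+c≤b+d = ≤-from₁ c≤d (solve 3 (λ b c d → (b :+ d) :- (b :+ c) := d :- c) refl b c d)

  +-mono-≤ : ∀ {a b c d} → a ≤ b → c ≤ d → a + c ≤ b + d
  +-mono-≤ {a} {b} {c} {d} a≤b c≤d = ≤-from₂ a≤b c≤d
    (solve 4 (λ a b c d → (b :+ d) :- (a :+ c) := (b :- a) :+ (d :- c)) refl a b c d)

  +-monoʳ-≤ : ∀ a {c d} → c ≤ d → a + c ≤ a + d
  +-monoʳ-≤ a = +-mono-≤ ≤.refl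

  -‿antimono-≤ : ∀ {a b} → a ≤ b → - b ≤ - a
  -‿antimono-≤ {a} {b} a≤b = ≤-from₁ a≤b (solve 2 (λ a b → :- a :- (:- b) := b :- a) refl a b)

  x≤x+y : ∀ x {y} → 0# ≤ y → x ≤ x + y
  x≤x+y x {y} 0≤y = ≤-from₁ 0≤y (solve 2 (λ x y → x :+ y :- x := y :- :0) refl x y)

  x-y≤x : ∀ x {y} → 0# ≤ y → x - y ≤ x
  x-y≤x x {y} 0≤y = ≤-from₁ 0≤y (solve 2 (λ x y → x :- (x :- y) := y :- :0) refl x y)

  x≤y⇒0≤y-x : ∀ {x y} → x ≤ y → 0# ≤ y - x
  x≤y⇒0≤y-x {x} {y} x≤y = ≤-from₁ x≤y (solve 2 (λ x y → (y :- x) :- :0 := y :- x) refl x y)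

  x+y≤z⇒y≤z-x : ∀ {x y z} → x + y ≤ z → y ≤ z - x
  x+y≤z⇒y≤z-x {x} {y} {z} h = ≤-from₁ h (solve 3 (λ x y z → (z :- x) :- y := z :- (x :+ y)) refl x y z)

  x≤z-y⇒y≤z-x : ∀ {x y z} → x ≤ z - y → y ≤ z - x
  x≤z-y⇒y≤z-x {x} {y} {z} h = ≤-from₁ h (solve 3 (λ x y z → (z :- x) :- y := (z :- y) :- x) refl x y z)

  x≤z-y⇒x+y≤z : ∀ {x y z} → x ≤ z - y → x + y ≤ z
  x≤z-y⇒x+y≤z {x} {y} {z} h = ≤-from₁ h (solve 3 (λ x y z → z :- (x :+ y) := (z :- y) :- x) refl x y z)

  x≤y+z⇒x-y≤z : ∀ {x y z} → x ≤ y + z → x - y ≤ z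
  x≤y+z⇒x-y≤z {x} {y} {z} h = ≤-from₁ h (solve 3 (λ x y z → z :- (x :- y) := (y :+ z) :- x) refl x y z)

  x-y≤z⇒x-z≤y : ∀ {x y z} → x - y ≤ z → x - z ≤ y
  x-y≤z⇒x-z≤y {x} {y} {z} h = ≤-from₁ h (solve 3 (λ x y z → y :- (x :- z) := z :- (x :- y)) refl x y z)

  x-y≤z⇒x≤z+y : ∀ {x y z} → x - y ≤ z → x ≤ z + y
  x-y≤z⇒x≤z+y {x} {y} {z} h = ≤-from₁ h (solve 3 (λ x y z → (z :+ y) :- x := z :- (x :- y)) refl x y z)

  *-monoʳ-≤ : ∀ {a x y} → 0# ≤ a → x ≤ y → a * x ≤ a * y
  *-monoʳ-≤ {a} {x} {y} 0≤a x≤y = ≤-from₁ (*-nonneg 0≤a (x≤y⇒0≤y-x x≤y))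
    (solve 3 (λ a x y → a :* y :- a :* x := a :* (y :- x) :- :0) refl a x y)

  *-mono-≤ : ∀ {a b c d} → 0# ≤ a → 0# ≤ c → a ≤ b → c ≤ d → a * c ≤ b * d
  *-mono-≤ {a} {b} {c} {d} 0≤a 0≤c a≤b c≤d = ≤.trans (*-monoʳ-≤ 0≤a c≤d)
    (≤.≤-respˡ-≈ (*-comm d a) (≤.≤-respʳ-≈ (*-comm d b) (*-monoʳ-≤ (≤.trans 0≤c c≤d) a≤b)))

  1>0 : 1# >0
  1>0 1≤0 = 0≉1 (≤.antisym 0≤1 1≤0)

  >0-resp-≤ : ∀ {x y} → x >0 → x ≤ y → y >0
  >0-resp-≤ x>0 x≤y y≤0 = x>0 (≤.trans x≤y y≤0)

  >0⇒≉0 : ∀ {x} → x >0 → ¬ (x ≈ 0#)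
  >0⇒≉0 x>0 x≈0 = x>0 (≤.reflexive x≈0)

  inverse-pos : ∀ {x} → x >0 → ∃[ y ] (y >0 × x * y ≈ 1#)
  inverse-pos {x} x>0 with inverse x (>0⇒≉0 x>0)
  ... | y , xy≈1 = y , y>0 , xy≈1
    where
    y>0 : y >0
    y>0 y≤0 = 1>0 (≤.≤-respˡ-≈ xy≈1 (≤.≤-respʳ-≈ (zeroʳ x) (*-monoʳ-≤ (>0⇒≥0 x>0) y≤0)))

  -- Multiplying `x * y ≤ 0#` by the positive inverse of `x` would give `y ≤ 0#`.
  *-pos : ∀ {x y} → x >0 → y >0 → x * y >0
  *-pos {x} {y} x>0 y>0 xy≤0 =
    let x⁻¹ , x⁻¹>0 , xx⁻¹≈1 = inverse-pos x>0
        x⁻¹xy≈y : x⁻¹ * (x * y) ≈ y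
        x⁻¹xy≈y = trans (solve 3 (λ x x⁻¹ y → x⁻¹ :* (x :* y) := (x :* x⁻¹) :* y) refl x x⁻¹ y)
                 (trans (*-congʳ xx⁻¹≈1) (*-identityˡ y))
    in y>0 (≤.≤-respˡ-≈ x⁻¹xy≈y (≤.≤-respʳ-≈ (zeroʳ x⁻¹) (*-monoʳ-≤ (>0⇒≥0 x⁻¹>0) xy≤0)))

  ⊓-pos : ∀ {x y} → x >0 → y >0 → (x ⊓ y) >0
  ⊓-pos {x} {y} x>0 y>0 x⊓y≤0 with ⊓-sel x y
  ... | inj₁ x⊓y≈x = x>0 (≤.≤-respˡ-≈ x⊓y≈x x⊓y≤0)
  ... | inj₂ x⊓y≈y = y>0 (≤.≤-respˡ-≈ x⊓y≈y x⊓y≤0)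

  ½ : ∃[ h ] (h >0 × h + h ≈ 1#)
  ½ =
    let h , h>0 , 2h≈1 = inverse-pos (>0-resp-≤ 1>0 (x≤x+y 1# 0≤1))
    in h , h>0 , trans (solve 1 (λ h → h :+ h := (:1 :+ :1) :* h) refl h) 2h≈1

  -- Half of the gap `x - y` serves as ε: a violation would make this half nonpositive. Inequalities
  -- may therefore be proved up to an arbitrary positive error.
  ≰⇒≰+ε : ∀ {x y} → ¬ (x ≤ y) → ∃[ ε ] (ε >0 × ¬ (x ≤ y + ε))
  ≰⇒≰+ε {x} {y} x≰y =
    let h , h>0 , 2h≈1 = ½
        d = x - y
        hd>0 : h * d >0
        hd>0 = *-pos h>0 λ d≤0 →
          x≰y (≤-from₁ d≤0 (solve 2 (λ x y → y :- x := :0 :- (x :- y)) refl x y))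
        hd+hd≈d : h * d + h * d ≈ d
        hd+hd≈d = trans (sym (distribʳ d h h)) (trans (*-congʳ 2h≈1) (*-identityˡ d))
    in h * d , hd>0 , λ x≤y+hd → hd>0 (≤-from₁ x≤y+hd (trans
         (solve 3 (λ y d′ x → :0 :- d′ := (y :+ d′) :- (y :+ (d′ :+ d′))) refl y (h * d) x)
         (+-congˡ (-‿cong (trans (+-congˡ hd+hd≈d) (solve 2 (λ x y → y :+ (x :- y) := x) refl x y))))))

  -- For `l ≤ r` this is the nearest point of `[l, r]` to `t`. It cuts rectangles at any height and
  -- measures overlaps of intervals without case distinctions.
  clamp : Carrier → Carrier → Carrier → Carrier
  clamp l r t = l ⊔ (r ⊓ t)

  module _ {l r : Carrier} where
    clamp-mono : ∀ {s t} → s ≤ t → clamp l r s ≤ clamp l r t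
    clamp-mono s≤t = ⊔-mono-≤ ≤.refl (⊓-mono-≤ ≤.refl s≤t)

    l≤clamp : ∀ t → l ≤ clamp l r t
    l≤clamp t = x≤x⊔y l (r ⊓ t)

    clamp≤r : l ≤ r → ∀ t → clamp l r t ≤ r
    clamp≤r l≤r t = ⊔-lub l≤r (x⊓y≤x r t)

    clamp-inside : ∀ {t} → l ≤ t → t ≤ r → clamp l r t ≈ t
    clamp-inside {t} l≤t t≤r = ≤.antisym (⊔-lub l≤t (x⊓y≤y r t))
      (≤.trans (⊓-glb t≤r ≤.refl) (x≤y⊔x l (r ⊓ t)))

-- Series of nonnegative terms.

module PartialSums (ℝ : CompleteOrderedField) where
  open CompleteOrderedField ℝ hiding (zero)
  open OrderedFieldProperties ℝ
  open IntegerCoefficientSolver commutativeRing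
  open CommSemigroupProps +-commutativeSemigroup using (interchange)
  open FiniteSum +-commutativeMonoid using (sum)

  Nonnegative : (ℕ → Carrier) → Set
  Nonnegative f = ∀ n → 0# ≤ f n

  partial : (ℕ → Carrier) → ℕ → Carrier
  partial f n = sum {n} (f ∘ toℕ)

  -- Sums are handled through the upper bounds of their partial sums, which avoids constructing
  -- limits.
  SumBound : (ℕ → Carrier) → Carrier → Set
  SumBound f u = ∀ n → partial f n ≤ u

  partial-mono : ∀ {f} → Nonnegative f → ∀ {m n} → m ℕ.≤ n → partial f m ≤ partial f n
  partial-mono f≥0 {n = zero}  z≤n       = ≤.refl
  partial-mono f≥0 {n = suc n} z≤n       = ≤.trans (f≥0 0) (x≤x+y _ (partial-mono (f≥0 ∘ suc) (z≤n {n})))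
  partial-mono f≥0             (s≤s m≤n) = +-monoʳ-≤ _ (partial-mono (f≥0 ∘ suc) m≤n)

  term≤partial : ∀ {f} → Nonnegative f → ∀ n → f n ≤ partial f (suc n)
  term≤partial f≥0 zero    = x≤x+y _ ≤.refl
  term≤partial f≥0 (suc n) = ≤.trans (term≤partial (f≥0 ∘ suc) n)
    (≤.≤-respˡ-≈ (+-identityˡ _) (+-monoˡ-≤ _ (f≥0 0)))

  partial-mono-terms : ∀ {f g} → (∀ n → f n ≤ g n) → ∀ n → partial f n ≤ partial g n
  partial-mono-terms f≤g zero    = ≤.refl
  partial-mono-terms f≤g (suc n) = +-mono-≤ (f≤g 0) (partial-mono-terms (f≤g ∘ suc) n)

  partial-+ : ∀ {f g h} → (∀ n → h n ≈ f n + g n) → ∀ n → partial h n ≈ partial f n + partial g n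
  partial-+ h≈f+g zero    = sym (+-identityˡ 0#)
  partial-+ h≈f+g (suc n) = trans (+-cong (h≈f+g 0) (partial-+ (h≈f+g ∘ suc) n)) (interchange _ _ _ _)

  -- The `m`-th partial sum of `f` and the `n`-th of `g` together stay below the partial sum of `h`
  -- at the larger index. So `u - partial f m` bounds the sums of `g` and is at least `b`; hence
  -- `u - b` bounds the sums of `f` and is at least `a`.
  sumBound-+ : ∀ {f g h a b} → Nonnegative f → Nonnegative g → (∀ n → h n ≈ f n + g n) →
               (∀ u → SumBound f u → a ≤ u) → (∀ u → SumBound g u → b ≤ u) →
               ∀ u → SumBound h u → a + b ≤ u
  sumBound-+ {f} {g} {h} {a} {b} f≥0 g≥0 h≈f+g a≤ b≤ u h≤u =
    x≤z-y⇒x+y≤z (a≤ (u - b) λ m → x≤z-y⇒y≤z-x (b≤ (u - partial f m) λ n → x+y≤z⇒y≤z-x (mixed m n)))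
    where
    mixed : ∀ m n → partial f m + partial g n ≤ u
    mixed m n = ≤.trans
      (+-mono-≤ (partial-mono f≥0 (ℕ.m≤m⊔n m n)) (partial-mono g≥0 (ℕ.m≤n⊔m m n)))
      (≤.≤-respˡ-≈ (partial-+ h≈f+g (m ℕ.⊔ n)) (h≤u (m ℕ.⊔ n)))

  -- The `n`-th term is `x` times the power `n + 1` of `q`. Accumulating the factor in `x` makes the
  -- tail again a geometric sequence by definition, as the induction on partial sums requires.
  geometric : Carrier → Carrier → ℕ → Carrier
  geometric q x zero    = q * x
  geometric q x (suc n) = geometric q (q * x) n

  geometric-pos : ∀ {q x} → q >0 → x >0 → ∀ n → geometric q x n >0
  geometric-pos q>0 x>0 zero    = *-pos q>0 x>0
  geometric-pos q>0 x>0 (suc n) = geometric-pos q>0 (*-pos q>0 x>0) n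

  halves-sumBound : ∀ {q x} → q >0 → q + q ≈ 1# → x >0 → SumBound (geometric q x) x
  halves-sumBound q>0 2q≈1 x>0 zero    = >0⇒≥0 x>0
  halves-sumBound {q} {x} q>0 2q≈1 x>0 (suc n) = ≤.≤-respʳ-≈
    (trans (sym (distribʳ x q q)) (trans (*-congʳ 2q≈1) (*-identityˡ x)))
    (+-monoʳ-≤ (q * x) (halves-sumBound q>0 2q≈1 (*-pos q>0 x>0) n))

-- Interleaving two sequences.

module _ {A : Set} where

  -- The sequences exchange roles at each step, so locating a term of one is reduced to locating a
  -- term of the other.
  interleave : (ℕ → A) → (ℕ → A) → ℕ → A
  interleave r s zero    = r 0
  interleave r s (suc n) = interleave s (r ∘ suc) n

  interleaveˡ : ∀ r s n → ∃[ k ] interleave r s k ≡ r n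
  interleaveʳ : ∀ r s n → ∃[ k ] interleave r s k ≡ s n
  interleaveˡ r s zero    = 0 , ≡.refl
  interleaveˡ r s (suc n) = let k , eq = interleaveʳ s (r ∘ suc) n in suc k , eq
  interleaveʳ r s n       = let k , eq = interleaveˡ s (r ∘ suc) n in suc k , eq

-- Outer measure: covers, subadditivity, horizontal cuts and strips.

module OuterMeasure (ℝ : CompleteOrderedField) where
  open CompleteOrderedField ℝ hiding (zero)
  open UnitSquare ℝ
  open Rectangle
  open OrderedFieldProperties ℝ
  open PartialSums ℝ
  open IntegerCoefficientSolver commutativeRing

  width height : Rectangle → Carrier
  width  r = right r - left r
  height r = top r - bottom r

  width≥0 : ∀ r → 0# ≤ width r
  width≥0 r = x≤y⇒0≤y-x (left≤right r)

  height≥0 : ∀ r → 0# ≤ height r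
  height≥0 r = x≤y⇒0≤y-x (bottom≤top r)

  area≥0 : ∀ r → 0# ≤ area r
  area≥0 r = *-nonneg (width≥0 r) (height≥0 r)

  μ-isInfimum : ∀ E → IsInfimum (CoverArea E) (value (μ E))
  μ-isInfimum E = proj₂ (infima (CoverArea E) (1# , 1∈CoverArea E) (0# , CoverArea≥0 E))

  μ≥0 : ∀ E → 0# ≤ value (μ E)
  μ≥0 E = proj₁ (proj₂ (μ E))

  μ≤1 : ∀ E → value (μ E) ≤ 1#
  μ≤1 E = proj₂ (proj₂ (μ E))

  -- Completeness supplies the total area that `CoverArea` asks for, so that a bound on the partial
  -- sums is all a cover has to come with.
  μ-upper : ∀ {E u} r → Covers r E → SumBound (area ∘ r) u → value (μ E) ≤ u
  μ-upper {E} {u} r covers Σ≤u = ≤.trans (proj₁ (μ-isInfimum E) s (r , covers , s-sup)) (proj₂ s-sup u ub)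
    where
    ub : IsUpperBound (λ t → ∃[ n ] (t ≈ partial (area ∘ r) n)) u
    ub t (n , t≈) = ≤.≤-respˡ-≈ (sym t≈) (Σ≤u n)
    supremum = complete (λ t → ∃[ n ] (t ≈ partial (area ∘ r) n)) (0# , 0 , refl) (u , ub)
    s = proj₁ supremum
    s-sup : HasTotalArea r s
    s-sup = proj₂ supremum

  μ-lower : ∀ {E b} → (∀ r u → Covers r E → SumBound (area ∘ r) u → b ≤ u) → b ≤ value (μ E)
  μ-lower {E} {b} h = proj₂ (μ-isInfimum E) b λ s (r , covers , s-ub , _) →
    h r s covers λ n → s-ub (partial (area ∘ r) n) (n , refl)

  -- Once the first area is split off, the tail of `r` is bounded by `u` minus that area, and the
  -- induction continues with the roles exchanged.
  interleave-sumBound : ∀ r s {u v} → SumBound (area ∘ r) u → SumBound (area ∘ s) v →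
                        SumBound (area ∘ interleave r s) (u + v)
  interleave-sumBound r s Σr≤u Σs≤v zero = ≤.trans (Σr≤u 0) (x≤x+y _ (Σs≤v 0))
  interleave-sumBound r s {u} {v} Σr≤u Σs≤v (suc n) =
    ≤.≤-respʳ-≈ (solve 3 (λ a u v → a :+ (v :+ (u :- a)) := u :+ v) refl (area (r 0)) u v)
      (+-monoʳ-≤ (area (r 0)) (interleave-sumBound s (r ∘ suc) Σs≤v (λ k → x+y≤z⇒y≤z-x (Σr≤u (suc k))) n))

  interleave-covers : ∀ {A B C} r s → A ⊆ B ∪ C → Covers r B → Covers s C → Covers (interleave r s) A
  interleave-covers r s A⊆B∪C coversB coversC p p∈A = [ fromB , fromC ]′ (A⊆B∪C p∈A)
    where
    fromB = λ p∈B →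
      let n , p∈rₙ = coversB p p∈B
          k , eq = interleaveˡ r s n
      in k , ≡.subst (p ∈ᴿ_) (≡.sym eq) p∈rₙ
    fromC = λ p∈C →
      let n , p∈sₙ = coversC p p∈C
          k , eq = interleaveʳ r s n
      in k , ≡.subst (p ∈ᴿ_) (≡.sym eq) p∈sₙ

  -- Covers of `B` and `C` interleave to a cover of `A`. Rearranging the inequality isolates `μ B`
  -- and then `μ C`, so each infimum is taken in turn and no ε is introduced.
  μ-subadditive : ∀ {A B C} → A ⊆ B ∪ C → value (μ A) ≤ value (μ B) + value (μ C)
  μ-subadditive {A} {B} {C} A⊆B∪C = x-y≤z⇒x≤z+y (μ-lower λ r u coversB Σr≤u →
    x-y≤z⇒x-z≤y (μ-lower λ s v coversC Σs≤v →
      x≤y+z⇒x-y≤z (μ-upper (interleave r s) (interleave-covers r s A⊆B∪C coversB coversC)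
                                            (interleave-sumBound r s Σr≤u Σs≤v))))

  μ-mono : ∀ {A B} → A ⊆ B → value (μ A) ≤ value (μ B)
  μ-mono A⊆B = μ-lower λ r u covers → μ-upper r λ p p∈A → covers p (A⊆B p∈A)

  -- If `c` misses the vertical range of `r`, clamping makes one piece degenerate, of area zero, and
  -- the other equal in extent to `r`.
  below above : Carrier → Rectangle → Rectangle
  below c r = record
    { left = left r ; right = right r ; left≤right = left≤right r
    ; bottom = bottom r ; top = clamp (bottom r) (top r) c
    ; bottom≤top = l≤clamp c }
  above c r = record
    { left = left r ; right = right r ; left≤right = left≤right r
    ; bottom = clamp (bottom r) (top r) c ; top = top r
    ; bottom≤top = clamp≤r (bottom≤top r) c }

  area-cut : ∀ c r → area r ≈ area (below c r) + area (above c r)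
  area-cut c r = solve 4 (λ w b m t → w :* (t :- b) := w :* (m :- b) :+ w :* (t :- m)) refl
    (width r) (bottom r) (clamp (bottom r) (top r) c) (top r)

  ∈-below : ∀ {c} p r → p ∈ᴿ r → value (proj₂ p) ≤ c → p ∈ᴿ below c r
  ∈-below p r (x∈ , b≤y , y≤t) y≤c = x∈ , b≤y , ≤.≤-respˡ-≈ (clamp-inside b≤y y≤t) (clamp-mono y≤c)

  ∈-above : ∀ {c} p r → p ∈ᴿ r → c ≤ value (proj₂ p) → p ∈ᴿ above c r
  ∈-above p r (x∈ , b≤y , y≤t) c≤y = x∈ , ≤.≤-respʳ-≈ (clamp-inside b≤y y≤t) (clamp-mono c≤y) , y≤t

  -- From a cover of `A`, the lower pieces cover `B` and the upper pieces cover `C`. Both pieces are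
  -- closed, so points at height exactly `c` are caught on either side.
  μ-superadditive : ∀ {A B C} c → B ⊆ A → C ⊆ A →
                    (∀ p → p ∈ B → value (proj₂ p) ≤ c) → (∀ p → p ∈ C → c ≤ value (proj₂ p)) →
                    value (μ B) + value (μ C) ≤ value (μ A)
  μ-superadditive {A} {B} {C} c B⊆A C⊆A B≤c c≤C = μ-lower λ r u covers →
    sumBound-+ (area≥0 ∘ below c ∘ r) (area≥0 ∘ above c ∘ r) (area-cut c ∘ r)
      (λ v → μ-upper (below c ∘ r) λ p p∈B → let n , p∈rₙ = covers p (B⊆A p∈B) in
        n , ∈-below p (r n) p∈rₙ (B≤c p p∈B))
      (λ v → μ-upper (above c ∘ r) λ p p∈C → let n , p∈rₙ = covers p (C⊆A p∈C) in
        n , ∈-above p (r n) p∈rₙ (c≤C p p∈C))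
      u

  μ-strip : ∀ {E c d} → c ≤ d → (∀ p → p ∈ E → c ≤ value (proj₂ p) × value (proj₂ p) ≤ d) →
            value (μ E) ≤ d - c
  μ-strip {E} {c} {d} c≤d E⊆ = μ-upper r (λ (x , y) p∈E → 0 , proj₂ x , E⊆ (x , y) p∈E) bound
    where
    strip edge : Rectangle
    strip = record { left = 0# ; right = 1# ; left≤right = 0≤1 ; bottom = c ; top = d ; bottom≤top = c≤d }
    -- Covers are infinite sequences; this segment of area zero fills all places after the first.
    edge  = record { left = 0# ; right = 1# ; left≤right = 0≤1 ; bottom = c ; top = c ; bottom≤top = ≤.refl }
    r : ℕ → Rectangle
    r zero    = strip
    r (suc _) = edge
    edges : ∀ n → partial (λ _ → area edge) n ≈ 0#
    edges zero    = refl
    edges (suc n) = trans (+-cong (solve 1 (λ c → (:1 :- :0) :* (c :- c) := :0) refl c) (edges n)) (+-identityˡ 0#)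
    bound : SumBound (area ∘ r) (d - c)
    bound zero    = x≤y⇒0≤y-x c≤d
    bound (suc n) = ≤.reflexive (trans (+-congˡ (edges n))
      (solve 2 (λ c d → (:1 :- :0) :* (d :- c) :+ :0 := d :- c) refl c d))

-- Cousin's lemma.

module Cousin (em : ExcludedMiddle 0ℓ) (ℝ : CompleteOrderedField) where
  open CompleteOrderedField ℝ hiding (zero)
  open OrderedFieldProperties ℝ
  open IntegerCoefficientSolver commutativeRing

  -- The point `p` may lie outside `[x, y]`, in contrast to the usual tagged intervals.
  Near : Carrier → Carrier → Carrier → Carrier → Set
  Near p ε x y = p - ε ≤ x × x ≤ y × y ≤ p + ε

  Locally : (Carrier → Carrier → Set) → Carrier → Set
  Locally G p = ∃[ ε ] (ε >0 × (∀ x y → Near p ε x y → G x y))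

  Concatenable : (Carrier → Carrier → Set) → Set
  Concatenable G = ∀ {x y z} → x ≤ y → y ≤ z → G x y → G y z → G x z

  -- Cousin's lemma: the supremum of the t for which G a t holds is c, since
  -- near that supremum every subinterval satisfies G.
  cousin : ∀ {G a c} → a ≤ c → Concatenable G → (∀ p → a ≤ p → p ≤ c → Locally G p) → G a c
  cousin {G} {a} {c} a≤c concat local = from-near-sup s-ε-not-bound
    where
    Reached : Pred Carrier 0ℓ
    Reached t = a ≤ t × t ≤ c × G a t

    a-reached : a ∈ Reached
    a-reached =
      let ε , ε>0 , near = local a ≤.refl a≤c
      in ≤.refl , a≤c , near a a (x-y≤x a (>0⇒≥0 ε>0) , ≤.refl , x≤x+y a (>0⇒≥0 ε>0))

    supremum : ∃[ s ] IsSupremum Reached s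
    supremum = complete Reached (a , a-reached) (c , λ _ → proj₁ ∘ proj₂)

    s : Carrier
    s = proj₁ supremum

    reached≤s : IsUpperBound Reached s
    reached≤s = proj₁ (proj₂ supremum)

    s-least : ∀ b → IsUpperBound Reached b → s ≤ b
    s-least = proj₂ (proj₂ supremum)

    at-s : Locally G s
    at-s = local s (reached≤s a a-reached) (s-least c λ _ → proj₁ ∘ proj₂)

    ε : Carrier
    ε = proj₁ at-s

    ε>0 : ε >0
    ε>0 = proj₁ (proj₂ at-s)

    s-ε-not-bound : ∃[ t ] (t ∈ Reached × s - ε ≤ t)
    -- Otherwise `s - ε` would be an upper bound smaller than the supremum.
    s-ε-not-bound = decidable-stable em λ none → ε>0
      (≤-from₁ (s-least (s - ε) λ t t∈ → ≰⇒≥ λ s-ε≤t → none (t , t∈ , s-ε≤t))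
        (solve 2 (λ s ε → :0 :- ε := (s :- ε) :- s) refl s ε))

    from-near-sup : ∃[ t ] (t ∈ Reached × s - ε ≤ t) → G a c
    from-near-sup (t , t∈@(a≤t , t≤c , Gat) , s-ε≤t) = [ ends , stops ]′ (≤.total c (s + ε))
      where
      ends : c ≤ s + ε → G a c
      ends c≤s+ε = concat a≤t t≤c Gat (proj₂ (proj₂ at-s) t c (s-ε≤t , t≤c , c≤s+ε))
      -- Here `s + ε` would itself be reached, beyond the supremum.
      stops : s + ε ≤ c → G a c
      stops s+ε≤c = contradiction
        (≤-from₁ (reached≤s (s + ε) s+ε-reached) (solve 2 (λ s ε → :0 :- ε := s :- (s :+ ε)) refl s ε)) ε>0
        where
        t≤s+ε : t ≤ s + ε
        t≤s+ε = ≤.trans (reached≤s t t∈) (x≤x+y s (>0⇒≥0 ε>0))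
        s+ε-reached : s + ε ∈ Reached
        s+ε-reached = ≤.trans a≤t t≤s+ε , s+ε≤c ,
          concat a≤t t≤s+ε Gat (proj₂ (proj₂ at-s) t (s + ε) (s-ε≤t , t≤s+ε , ≤.refl))

-- The square has measure at least one.

module SquareHasMeasureOne (em : ExcludedMiddle 0ℓ) (ℝ : CompleteOrderedField) where
  open CompleteOrderedField ℝ hiding (zero)
  open UnitSquare ℝ
  open Rectangle
  open OrderedFieldProperties ℝ
  open PartialSums ℝ
  open OuterMeasure ℝ
  open Cousin em ℝ
  open IntegerCoefficientSolver commutativeRing

  -- The length of [l , r] ∩ [x , y], written so that additivity in [x , y] is telescoping.
  span : Carrier → Carrier → Carrier → Carrier → Carrier
  span l r x y = clamp l r y - clamp l r x

  areaWithin : Rectangle → Carrier → Carrier → Carrier → Carrier → Carrier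
  areaWithin r a b c d = span (left r) (right r) a b * span (bottom r) (top r) c d

  span≥0 : ∀ l r {x y} → x ≤ y → 0# ≤ span l r x y
  span≥0 l r x≤y = x≤y⇒0≤y-x (clamp-mono x≤y)

  span≤ : ∀ {l r} → l ≤ r → ∀ x y → span l r x y ≤ r - l
  span≤ l≤r x y = +-mono-≤ (clamp≤r l≤r y) (-‿antimono-≤ (l≤clamp x))

  span-inside : ∀ {l r x y} → l ≤ x → x ≤ y → y ≤ r → span l r x y ≈ y - x
  span-inside l≤x x≤y y≤r =
    +-cong (clamp-inside (≤.trans l≤x x≤y) y≤r) (-‿cong (clamp-inside l≤x (≤.trans x≤y y≤r)))

  areaWithin≤area : ∀ r {a b c d} → a ≤ b → c ≤ d → areaWithin r a b c d ≤ area r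
  areaWithin≤area r a≤b c≤d = *-mono-≤ (span≥0 _ _ a≤b) (span≥0 _ _ c≤d)
    (span≤ (left≤right r) _ _) (span≤ (bottom≤top r) _ _)

  module Full (r : ℕ → Rectangle) where

    φ ψ : ℕ → Carrier → Carrier
    φ n = clamp (left (r n)) (right (r n))
    ψ n = clamp (bottom (r n)) (top (r n))

    within : Carrier → Carrier → Carrier → Carrier → ℕ → Carrier
    within a b c d n = areaWithin (r n) a b c d

    within≥0 : ∀ {a b c d} → a ≤ b → c ≤ d → Nonnegative (within a b c d)
    within≥0 a≤b c≤d n = *-nonneg (span≥0 _ _ a≤b) (span≥0 _ _ c≤d)

    FullIn : Carrier → Carrier → Carrier → Carrier → Set
    FullIn a b c d = ∀ u → SumBound (within a b c d) u → (b - a) * (d - c) ≤ u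

    -- Overlap lengths telescope along `x`, `y`, `z`, so each term over the long rectangle is the
    -- sum of the two terms over its parts; `sumBound-+` then adds the lower bounds.
    full-concatˣ : ∀ {c d} → c ≤ d → Concatenable (λ a b → FullIn a b c d)
    full-concatˣ {c} {d} c≤d {x} {y} {z} x≤y y≤z full₁ full₂ u h =
      ≤.≤-respˡ-≈ (solve 4 (λ x y z h → (y :- x) :* h :+ (z :- y) :* h := (z :- x) :* h) refl x y z (d - c))
        (sumBound-+ (within≥0 x≤y c≤d) (within≥0 y≤z c≤d)
          (λ n → solve 4 (λ x y z h → (z :- x) :* h := (y :- x) :* h :+ (z :- y) :* h) refl
            (φ n x) (φ n y) (φ n z) (span (bottom (r n)) (top (r n)) c d))
          full₁ full₂ u h)

    full-concatʸ : ∀ {a b} → a ≤ b → Concatenable (λ c d → FullIn a b c d)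
    full-concatʸ {a} {b} a≤b {x} {y} {z} x≤y y≤z full₁ full₂ u h =
      ≤.≤-respˡ-≈ (solve 4 (λ x y z w → w :* (y :- x) :+ w :* (z :- y) := w :* (z :- x)) refl x y z (b - a))
        (sumBound-+ (within≥0 a≤b x≤y) (within≥0 a≤b y≤z)
          (λ n → solve 4 (λ x y z w → w :* (z :- x) := w :* (y :- x) :+ w :* (z :- y)) refl
            (ψ n x) (ψ n y) (ψ n z) (span (left (r n)) (right (r n)) a b))
          full₁ full₂ u h)

    -- The single term of a rectangle that contains the whole subrectangle already equals the area
    -- of the latter.
    full-inside : ∀ n {a b c d} → left (r n) ≤ a → a ≤ b → b ≤ right (r n) →
                  bottom (r n) ≤ c → c ≤ d → d ≤ top (r n) → FullIn a b c d
    full-inside n l≤a a≤b b≤r b≤c c≤d d≤t u h = ≤.≤-respˡ-≈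
      (*-cong (span-inside l≤a a≤b b≤r) (span-inside b≤c c≤d d≤t))
      (≤.trans (term≤partial (within≥0 a≤b c≤d) n) (h (suc n)))

    LocallyFull : I → I → Set
    LocallyFull x y = ∃[ δ ] (δ >0 × (∀ a b c d → Near (value x) δ a b → Near (value y) δ c d → FullIn a b c d))

    full : (∀ x y → LocallyFull x y) → FullIn 0# 1# 0# 1#
    full local = cousin 0≤1 (full-concatˣ 0≤1) λ p 0≤p p≤1 → column (p , 0≤p , p≤1)
      where
      near-⊓ : ∀ {p ε ε′ x y} → Near p (ε ⊓ ε′) x y → Near p ε x y × Near p ε′ x y
      near-⊓ {p} {ε} {ε′} (lo , x≤y , hi) =
        (≤.trans (+-monoʳ-≤ p (-‿antimono-≤ (x⊓y≤x ε ε′))) lo , x≤y , ≤.trans hi (+-monoʳ-≤ p (x⊓y≤x ε ε′))) ,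
        (≤.trans (+-monoʳ-≤ p (-‿antimono-≤ (x⊓y≤y ε ε′))) lo , x≤y , ≤.trans hi (+-monoʳ-≤ p (x⊓y≤y ε ε′)))
      column : ∀ x → Locally (λ a b → FullIn a b 0# 1#) (value x)
      -- The outer application of Cousin's lemma needs one width that works for the full height. The
      -- inner predicate therefore carries a width of its own, and stacking two vertical intervals
      -- takes the minimum of their widths.
      column x = cousin {λ c d → Locally (λ a b → FullIn a b c d) (value x)} 0≤1
        (λ x≤y y≤z (ε , ε>0 , near) (ε′ , ε′>0 , near′) → ε ⊓ ε′ , ⊓-pos ε>0 ε′>0 , λ a b n →
          let n₁ , n₂ = near-⊓ n
          in full-concatʸ (proj₁ (proj₂ n)) x≤y y≤z (near a b n₁) (near′ a b n₂))
        (λ p 0≤p p≤1 → let δ , δ>0 , near = local x (p , 0≤p , p≤1) in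
          δ , δ>0 , λ c d cd → δ , δ>0 , λ a b ab → near a b c d ab cd)

  -- The margin turns every point of the original rectangle into an interior point, with room for
  -- all nearby subrectangles.
  enlarge : ∀ δ → δ >0 → Rectangle → Rectangle
  enlarge δ δ>0 r = record
    { left = left r - δ ; right = right r + δ ; bottom = bottom r - δ ; top = top r + δ
    ; left≤right = widen (left≤right r) ; bottom≤top = widen (bottom≤top r) }
    where
    widen : ∀ {x y} → x ≤ y → x - δ ≤ y + δ
    widen {x} {y} x≤y = ≤.trans (x-y≤x x (>0⇒≥0 δ>0)) (≤.trans x≤y (x≤x+y y (>0⇒≥0 δ>0)))

  -- With w and h the sides of r and D = 2δ, the area grows by D (w + h + D);
  -- D = ε / (w + h + 1 + ε) makes D ≤ 1, so that this is at most ε.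
  enlarge-slightly : ∀ r {ε} → ε >0 → ∃[ δ ] ∃[ δ>0 ] (area (enlarge δ δ>0 r) ≤ area r + ε)
  enlarge-slightly r {ε} ε>0 = δ , δ>0 , ≤.≤-respˡ-≈ (sym area≈) (+-monoʳ-≤ (area r) D*[w+h+D]≤ε)
    where
    w h M : Carrier
    w = width r
    h = height r
    M = (w + h) + (1# + ε)
    ε≥0 : 0# ≤ ε
    ε≥0 = >0⇒≥0 ε>0
    w+h≥0 : 0# ≤ w + h
    w+h≥0 = ≤.≤-respˡ-≈ (+-identityˡ 0#) (+-mono-≤ (width≥0 r) (height≥0 r))
    1+ε≤M : 1# + ε ≤ M
    1+ε≤M = ≤.≤-respˡ-≈ (+-identityˡ _) (+-monoˡ-≤ (1# + ε) w+h≥0)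
    inv = inverse-pos (>0-resp-≤ 1>0 (≤.trans (x≤x+y 1# ε≥0) 1+ε≤M))
    m = proj₁ inv
    m>0 = proj₁ (proj₂ inv)
    M*m≈1 : M * m ≈ 1#
    M*m≈1 = proj₂ (proj₂ inv)
    D = ε * m
    D>0 = *-pos ε>0 m>0
    q = proj₁ ½
    δ = q * D
    δ>0 = *-pos (proj₁ (proj₂ ½)) D>0
    δ+δ≈D : δ + δ ≈ D
    δ+δ≈D = trans (sym (distribʳ D q q)) (trans (*-congʳ (proj₂ (proj₂ ½))) (*-identityˡ D))
    D≤1 : D ≤ 1#
    D≤1 = ≤.≤-respˡ-≈ (*-comm m ε) (≤.≤-respʳ-≈ (trans (*-comm m M) M*m≈1)
      (*-monoʳ-≤ (>0⇒≥0 m>0) (≤.trans (≤.≤-respʳ-≈ (+-comm ε 1#) (x≤x+y ε 0≤1)) 1+ε≤M)))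
    D*[w+h+D]≤ε : D * ((w + h) + D) ≤ ε
    D*[w+h+D]≤ε = ≤.≤-respʳ-≈
      (trans (solve 3 (λ ε m M → (ε :* m) :* M := (M :* m) :* ε) refl ε m M) (trans (*-congʳ M*m≈1) (*-identityˡ ε)))
      (*-monoʳ-≤ (>0⇒≥0 D>0) (+-monoʳ-≤ (w + h) (≤.trans D≤1 (x≤x+y 1# ε≥0))))
    area≈ : area (enlarge δ δ>0 r) ≈ area r + D * ((w + h) + D)
    area≈ = trans
      (solve 5 (λ l r b t δ → ((r :+ δ) :- (l :- δ)) :* ((t :+ δ) :- (b :- δ)) :=
          (r :- l) :* (t :- b) :+ (δ :+ δ) :* (((r :- l) :+ (t :- b)) :+ (δ :+ δ))) refl
        (left r) (right r) (bottom r) (top r) δ)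
      (+-congˡ (*-cong δ+δ≈D (+-congˡ δ+δ≈D)))

  covers-square⇒1≤ : ∀ r u → Covers r U → SumBound (area ∘ r) u → 1# ≤ u
  -- It suffices to prove the bound `u + ε` for every positive ε.
  covers-square⇒1≤ r u covers Σ≤u = decidable-stable em λ 1≰u →
    let ε , ε>0 , 1≰u+ε = ≰⇒≰+ε 1≰u in 1≰u+ε (bound ε ε>0)
    where
    bound : ∀ ε → ε >0 → 1# ≤ u + ε
    bound ε ε>0 = ≤.≤-respˡ-≈ (solve 0 ((:1 :- :0) :* (:1 :- :0) := :1) refl)
      (full locallyFull (u + ε) within-sumBound)
      where
      q = proj₁ ½
      q>0 = proj₁ (proj₂ ½)
      2q≈1 = proj₂ (proj₂ ½)
      -- The rectangle with index `k` may gain at most ε divided by the power `k + 1` of two, so the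
      -- total gain stays within ε.
      slightly = λ k → enlarge-slightly (r k) (geometric-pos q>0 ε>0 k)
      r′ : ℕ → Rectangle
      r′ k = enlarge (proj₁ (slightly k)) (proj₁ (proj₂ (slightly k))) (r k)
      area-r′≤ : ∀ k → area (r′ k) ≤ area (r k) + geometric q ε k
      area-r′≤ k = proj₂ (proj₂ (slightly k))
      open Full r′
      within-sumBound : SumBound (within 0# 1# 0# 1#) (u + ε)
      within-sumBound n = ≤.trans
        (partial-mono-terms {within 0# 1# 0# 1#} {λ k → area (r k) + geometric q ε k}
          (λ k → ≤.trans (areaWithin≤area (r′ k) 0≤1 0≤1) (area-r′≤ k)) n)
        (≤.≤-respˡ-≈ (sym (partial-+ {area ∘ r} {geometric q ε} (λ _ → refl) n))
          (+-mono-≤ (Σ≤u n) (halves-sumBound q>0 2q≈1 ε>0 n)))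
      locallyFull : ∀ x y → LocallyFull x y
      locallyFull x y =
        -- The margin of any rectangle that covers the point serves as the local radius there.
        let n , (l≤x , x≤r) , (b≤y , y≤t) = covers (x , y) _
            δ , δ>0 , _ = slightly n
        in δ , δ>0 , λ a b c d (x-δ≤a , a≤b , b≤x+δ) (y-δ≤c , c≤d , d≤y+δ) →
          full-inside n
            (≤.trans (+-monoˡ-≤ (- δ) l≤x) x-δ≤a) a≤b (≤.trans b≤x+δ (+-monoˡ-≤ δ x≤r))
            (≤.trans (+-monoˡ-≤ (- δ) b≤y) y-δ≤c) c≤d (≤.trans d≤y+δ (+-monoˡ-≤ δ y≤t))

  1≤μU : 1# ≤ value (μ U)
  1≤μU = μ-lower covers-square⇒1≤

-- Measurability and the three measures.

module Lebesgue (em : ExcludedMiddle 0ℓ) (ℝ : CompleteOrderedField) where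
  open CompleteOrderedField ℝ hiding (zero)
  open UnitSquare ℝ
  open OrderedFieldProperties ℝ
  open OuterMeasure ℝ
  open SquareHasMeasureOne em ℝ
  open IntegerCoefficientSolver commutativeRing

  ⊆-splits : ∀ {A E : Pred Q 0ℓ} → A ⊆ (A ∩ E) ∪ (A ∖ E)
  ⊆-splits p∈A = [ (λ p∈E → inj₁ (p∈A , p∈E)) , (λ p∉E → inj₂ (p∈A , p∉E)) ]′ (toSum em)

  measurable-if : ∀ {E} → (∀ A → value (μ (A ∩ E)) + value (μ (A ∖ E)) ≤ value (μ A)) → LebesgueMeasurable E
  measurable-if {E} h A = ≤.antisym (μ-subadditive {A} {A ∩ E} {A ∖ E} (⊆-splits {A} {E})) (h A)

  measurable-R⁰ : ∀ a → LebesgueMeasurable (R⁰ a)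
  measurable-R⁰ a = measurable-if λ A →
    μ-superadditive {A} {A ∩ R⁰ a} {A ∖ R⁰ a} (value a) proj₁ proj₁ (λ _ → proj₂) (λ _ → ≰⇒≥ ∘ proj₂)

  measurable-R¹ : ∀ b → LebesgueMeasurable (R¹ b)
  measurable-R¹ b = measurable-if λ A → ≤.≤-respˡ-≈ (+-comm _ _)
    (μ-superadditive {A} {A ∖ R¹ b} {A ∩ R¹ b} (1# - value b) proj₁ proj₁ (λ _ → ≰⇒≥ ∘ proj₂) (λ _ → proj₂))

  measurable-∁ : ∀ {E} → LebesgueMeasurable E → LebesgueMeasurable (∁ E)
  measurable-∁ {E} mE = measurable-if λ A → ≤.≤-respʳ-≈ (trans (+-comm _ _) (sym (mE A)))
    (+-monoʳ-≤ _ (μ-mono {A ∖ ∁ E} {A ∩ E} λ (p∈A , p∉∁E) → p∈A , decidable-stable em p∉∁E))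

  -- Test `E` on `A` and then `F` on `A ∩ E`; the two remainders `(A ∩ E) ∖ F` and `A ∖ E` together
  -- make up `A ∖ (E ∩ F)`.
  measurable-∩ : ∀ {E F} → LebesgueMeasurable E → LebesgueMeasurable F → LebesgueMeasurable (E ∩ F)
  measurable-∩ {E} {F} mE mF = measurable-if λ A → ≤.≤-respʳ-≈
    (trans (sym (+-assoc _ _ _)) (trans (+-congʳ (sym (mF (A ∩ E)))) (sym (mE A))))
    (+-mono-≤
      (μ-mono {A ∩ (E ∩ F)} {(A ∩ E) ∩ F} λ (p∈A , p∈E , p∈F) → (p∈A , p∈E) , p∈F)
      (μ-subadditive {A ∖ (E ∩ F)} {(A ∩ E) ∖ F} {A ∖ E} λ (p∈A , p∉E∩F) →
        [ (λ p∈E → inj₁ ((p∈A , p∈E) , λ p∈F → p∉E∩F (p∈E , p∈F))) , (λ p∉E → inj₂ (p∈A , p∉E)) ]′ (toSum em)))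

  -- Dually, `F` is tested on `A ∖ E`, since `A ∩ E` and `(A ∖ E) ∩ F` make up `A ∩ (E ∪ F)`.
  measurable-∪ : ∀ {E F} → LebesgueMeasurable E → LebesgueMeasurable F → LebesgueMeasurable (E ∪ F)
  measurable-∪ {E} {F} mE mF = measurable-if λ A → ≤.≤-respʳ-≈
    (trans (+-assoc _ _ _) (trans (+-congˡ (sym (mF (A ∖ E)))) (sym (mE A))))
    (+-mono-≤
      (μ-subadditive {A ∩ (E ∪ F)} {A ∩ E} {(A ∖ E) ∩ F} λ (p∈A , p∈E∪F) →
        [ (λ p∈E → inj₁ (p∈A , p∈E))
        , (λ p∉E → inj₂ ((p∈A , p∉E) , [ (λ p∈E → contradiction p∈E p∉E) , id ]′ p∈E∪F)) ]′ (toSum em))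
      (μ-mono {A ∖ (E ∪ F)} {(A ∖ E) ∖ F} λ (p∈A , p∉E∪F) → (p∈A , p∉E∪F ∘ inj₁) , p∉E∪F ∘ inj₂))

  1≤μ+μ∁ : ∀ E → 1# ≤ value (μ E) + value (μ (∁ E))
  1≤μ+μ∁ E = ≤.trans 1≤μU (μ-subadditive {U} {E} {∁ E} λ _ → toSum em)

  μ∁≤⇒≤μ : ∀ {E x} → value (μ (∁ E)) ≤ 1# - x → x ≤ value (μ E)
  μ∁≤⇒≤μ {E} {x} h = ≤-from₂ (1≤μ+μ∁ E) h
    (solve 3 (λ m n x → m :- x := ((m :+ n) :- :1) :+ ((:1 :- x) :- n)) refl (value (μ E)) (value (μ (∁ E))) x)

  μ-R⁰≤ : ∀ a → value (μ (R⁰ a)) ≤ value a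
  μ-R⁰≤ a@(x , 0≤x , _) = ≤.≤-respʳ-≈ (solve 1 (λ x → x :- :0 := x) refl x)
    (μ-strip {R⁰ a} 0≤x λ (_ , y) y≤a → proj₁ (proj₂ y) , y≤a)

  μ-∁R⁰≤ : ∀ a → value (μ (∁ (R⁰ a))) ≤ 1# - value a
  μ-∁R⁰≤ a@(_ , _ , x≤1) = μ-strip {∁ (R⁰ a)} x≤1 λ (_ , y) y≰a → ≰⇒≥ y≰a , proj₂ (proj₂ y)

  μ-R¹≤ : ∀ b → value (μ (R¹ b)) ≤ value b
  μ-R¹≤ b = ≤.≤-respʳ-≈ (solve 1 (λ x → :1 :- (:1 :- x) := x) refl (value b))
    (μ-strip {R¹ b} (proj₂ (proj₂ (1ᴵ- b))) λ (_ , y) 1-b≤y → 1-b≤y , proj₂ (proj₂ y))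

  μ-∁R¹≤ : ∀ b → value (μ (∁ (R¹ b))) ≤ 1# - value b
  μ-∁R¹≤ b = ≤.≤-respʳ-≈ (solve 1 (λ x → x :- :0 := x) refl (1# - value b))
    (μ-strip {∁ (R¹ b)} (proj₁ (proj₂ (1ᴵ- b))) λ (_ , y) 1-b≰y → proj₁ (proj₂ y) , ≰⇒≥ 1-b≰y)

  μ-∁R⁰ : ∀ a → value (μ (∁ (R⁰ a))) ≈ 1# - value a
  μ-∁R⁰ a = ≤.antisym (μ-∁R⁰≤ a) (x-y≤z⇒x-z≤y (x≤y+z⇒x-y≤z
    (≤.trans (1≤μ+μ∁ (R⁰ a)) (≤.≤-respʳ-≈ (+-comm _ _) (+-monoˡ-≤ _ (μ-R⁰≤ a))))))

  μ-∪ : ∀ a b → value (μ (R⁰ a ∪ R¹ b)) ≈ 1# ⊓ (value a + value b)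
  μ-∪ a b = ≤.antisym
    (⊓-glb (μ≤1 (R⁰ a ∪ R¹ b)) (≤.trans (μ-subadditive {R⁰ a ∪ R¹ b} {R⁰ a} {R¹ b} id) (+-mono-≤ (μ-R⁰≤ a) (μ-R¹≤ b))))
    (μ∁≤⇒≤μ {R⁰ a ∪ R¹ b} ([ gap , no-gap ]′ (≤.total x (1# - y))))
    where
    x y : Carrier
    x = value a
    y = value b
    gap : x ≤ 1# - y → value (μ (∁ (R⁰ a ∪ R¹ b))) ≤ 1# - (1# ⊓ (x + y))
    gap x≤1-y = ≤-from₂
      (μ-strip {∁ (R⁰ a ∪ R¹ b)} x≤1-y λ _ p∉ → ≰⇒≥ (p∉ ∘ inj₁) , ≰⇒≥ (p∉ ∘ inj₂)) (x⊓y≤y 1# (x + y))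
      (solve 4 (λ x y m n → (:1 :- n) :- m := (((:1 :- y) :- x) :- m) :+ ((x :+ y) :- n)) refl x y
        (value (μ (∁ (R⁰ a ∪ R¹ b)))) (1# ⊓ (x + y)))
    no-gap : 1# - y ≤ x → value (μ (∁ (R⁰ a ∪ R¹ b))) ≤ 1# - (1# ⊓ (x + y))
    no-gap 1-y≤x = ≤-from₂
      -- The two sets overlap or touch, so the complement fits into the strip of height zero at `x`.
      (μ-strip {∁ (R⁰ a ∪ R¹ b)} (≤.refl {x}) λ _ p∉ → ≰⇒≥ (p∉ ∘ inj₁) , ≤.trans (≰⇒≥ (p∉ ∘ inj₂)) 1-y≤x)
      (x⊓y≤x 1# (x + y))
      (solve 3 (λ x m n → (:1 :- n) :- m := ((x :- x) :- m) :+ (:1 :- n)) refl x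
        (value (μ (∁ (R⁰ a ∪ R¹ b)))) (1# ⊓ (x + y)))

  -- The right side is `max(0, a + b - 1)`, written as the De Morgan dual of truncated addition. The
  -- lower bound comes from covering the complement by the two separate complements.
  μ-∩ : ∀ a b → value (μ (R⁰ a ∩ R¹ b)) ≈ 1# - (1# ⊓ ((1# - value a) + (1# - value b)))
  μ-∩ a b = ≤.antisym
    ([ disjoint , overlapping ]′ (≤.total x (1# - y)))
    (x-y≤z⇒x-z≤y (⊓-glb (x-y≤x 1# (μ≥0 (R⁰ a ∩ R¹ b)))
      (x≤y+z⇒x-y≤z (≤.trans (1≤μ+μ∁ (R⁰ a ∩ R¹ b)) (+-monoʳ-≤ _
        (≤.trans (μ-subadditive {∁ (R⁰ a ∩ R¹ b)} {∁ (R⁰ a)} {∁ (R¹ b)} λ p∉ →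
            [ (λ p∈R⁰ → inj₂ λ p∈R¹ → p∉ (p∈R⁰ , p∈R¹)) , inj₁ ]′ (toSum em))
          (+-mono-≤ (μ-∁R⁰≤ a) (μ-∁R¹≤ b))))))))
    where
    x y n : Carrier
    x = value a
    y = value b
    n = 1# ⊓ ((1# - x) + (1# - y))
    disjoint : x ≤ 1# - y → value (μ (R⁰ a ∩ R¹ b)) ≤ 1# - n
    disjoint x≤1-y = ≤-from₂
      (μ-strip {R⁰ a ∩ R¹ b} (≤.refl {x}) λ _ (p∈R⁰ , p∈R¹) → ≤.trans x≤1-y p∈R¹ , p∈R⁰)
      (x⊓y≤x 1# ((1# - x) + (1# - y)))
      (solve 3 (λ x m n → (:1 :- n) :- m := ((x :- x) :- m) :+ (:1 :- n)) refl x (value (μ (R⁰ a ∩ R¹ b))) n)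
    overlapping : 1# - y ≤ x → value (μ (R⁰ a ∩ R¹ b)) ≤ 1# - n
    overlapping 1-y≤x = ≤-from₂
      (μ-strip {R⁰ a ∩ R¹ b} 1-y≤x λ _ (p∈R⁰ , p∈R¹) → p∈R¹ , p∈R⁰)
      (x⊓y≤y 1# ((1# - x) + (1# - y)))
      (solve 4 (λ x y m n → (:1 :- n) :- m := ((x :- (:1 :- y)) :- m) :+ (((:1 :- x) :+ (:1 :- y)) :- n)) refl x y
        (value (μ (R⁰ a ∩ R¹ b))) n)

-- Truncated addition on the unit interval.

module TruncatedAddition (ℝ : CompleteOrderedField) where
  open CompleteOrderedField ℝ hiding (zero)
  open OrderedFieldProperties ℝ
  open IntegerCoefficientSolver commutativeRing

  infixl 6 _⊞_
  _⊞_ : Carrier → Carrier → Carrier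
  x ⊞ y = 1# ⊓ (x + y)

  ⊞-cong : ∀ {x x′ y y′} → x ≈ x′ → y ≈ y′ → x ⊞ y ≈ x′ ⊞ y′
  ⊞-cong x≈x′ y≈y′ = ⊓-cong refl (+-cong x≈x′ y≈y′)

  ⊞-comm : ∀ x y → x ⊞ y ≈ y ⊞ x
  ⊞-comm x y = ⊓-cong refl (+-comm x y)

  ⊞-saturated : ∀ {x y} → 1# ≤ x + y → x ⊞ y ≈ 1#
  ⊞-saturated = x≤y⇒x⊓y≈x

  ⊞-unsaturated : ∀ {x y} → x + y ≤ 1# → x ⊞ y ≈ x + y
  ⊞-unsaturated = x≤y⇒y⊓x≈x

  ⊞-identityˡ : ∀ {x} → x ≤ 1# → 0# ⊞ x ≈ x
  ⊞-identityˡ {x} x≤1 = trans (⊞-unsaturated (≤.≤-respˡ-≈ (sym (+-identityˡ x)) x≤1)) (+-identityˡ x)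

  ⊞-zeroˡ : ∀ {x} → 0# ≤ x → 1# ⊞ x ≈ 1#
  ⊞-zeroˡ 0≤x = ⊞-saturated (x≤x+y 1# 0≤x)

  -- If the inner sum is truncated, adding the nonnegative `z` leaves both sides at one.
  -- Associativity thus follows from that of ordinary addition.
  ⊞-absorb : ∀ {x y z} → 0# ≤ z → (x ⊞ y) ⊞ z ≈ 1# ⊓ ((x + y) + z)
  ⊞-absorb {x} {y} {z} 0≤z = [ saturated , unsaturated ]′ (≤.total 1# (x + y))
    where
    saturated : 1# ≤ x + y → (x ⊞ y) ⊞ z ≈ 1# ⊓ ((x + y) + z)
    saturated 1≤x+y = trans (⊞-cong (⊞-saturated 1≤x+y) refl) (trans (⊞-zeroˡ 0≤z)
      (sym (⊞-saturated (≤.trans 1≤x+y (x≤x+y (x + y) 0≤z)))))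
    unsaturated : x + y ≤ 1# → (x ⊞ y) ⊞ z ≈ 1# ⊓ ((x + y) + z)
    unsaturated x+y≤1 = ⊞-cong (⊞-unsaturated x+y≤1) refl

  ⊞-assoc : ∀ {x y z} → 0# ≤ x → 0# ≤ z → (x ⊞ y) ⊞ z ≈ x ⊞ (y ⊞ z)
  ⊞-assoc {x} {y} {z} 0≤x 0≤z = trans (⊞-absorb 0≤z)
    (trans (⊓-cong refl (trans (+-assoc x y z) (+-comm x (y + z))))
    (trans (sym (⊞-absorb 0≤x)) (⊞-comm (y ⊞ z) x)))

  -- One side of the Łukasiewicz axiom. On the unit interval it is the maximum of `x` and `y`, which
  -- explains its symmetry.
  join : Carrier → Carrier → Carrier
  join x y = (1# - ((1# - x) ⊞ y)) ⊞ y

  x≤y⇒join≈y : ∀ {x y} → y ≤ 1# → x ≤ y → join x y ≈ y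
  x≤y⇒join≈y {x} {y} y≤1 x≤y = trans (⊞-cong 1-⊞≈0 refl) (⊞-identityˡ y≤1)
    where
    1-⊞≈0 : 1# - ((1# - x) ⊞ y) ≈ 0#
    1-⊞≈0 = trans (+-congˡ (-‿cong (⊞-saturated
      (≤-from₁ x≤y (solve 2 (λ x y → ((:1 :- x) :+ y) :- :1 := y :- x) refl x y))))) (-‿inverseʳ 1#)

  y≤x⇒join≈x : ∀ {x y} → x ≤ 1# → y ≤ x → join x y ≈ x
  y≤x⇒join≈x {x} {y} x≤1 y≤x = trans (⊓-cong refl 1-⊞+y≈x) (x≤y⇒y⊓x≈x x≤1)
    where
    1-⊞+y≈x : (1# - ((1# - x) ⊞ y)) + y ≈ x
    1-⊞+y≈x = trans
      (+-congʳ (+-congˡ (-‿cong (⊞-unsaturated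
        (≤-from₁ y≤x (solve 2 (λ x y → :1 :- ((:1 :- x) :+ y) := x :- y) refl x y))))))
      (solve 2 (λ x y → (:1 :- ((:1 :- x) :+ y)) :+ y := x) refl x y)

  join-comm : ∀ {x y} → x ≤ 1# → y ≤ 1# → join x y ≈ join y x
  join-comm {x} {y} x≤1 y≤1 =
    [ (λ x≤y → trans (x≤y⇒join≈y y≤1 x≤y) (sym (y≤x⇒join≈x y≤1 x≤y)))
    , (λ y≤x → trans (y≤x⇒join≈x x≤1 y≤x) (sym (x≤y⇒join≈y x≤1 y≤x))) ]′ (≤.total x y)

-- The dual of an MV-algebra.

module _ {a ℓ} {A : Set a} {_≈_ : Rel A ℓ} {_+_ _*_ : Op₂ A} {∼_ : Op₁ A} {e u : A} where

  -- The involution `∼_` carries `_+_` to `_*_` and exchanges `e` with `u`, so every axiom is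
  -- transported along it.
  isMVAlgebra-dual : IsMVAlgebra _≈_ _+_ ∼_ e u → (∀ x y → (x * y) ≈ (∼ ((∼ x) + (∼ y)))) →
                     IsMVAlgebra _≈_ _*_ ∼_ u e
  isMVAlgebra-dual mv *-def = record
    { isCommutativeMonoid = record
      { isMonoid = record
        { isSemigroup = record
          { isMagma = record
            { isEquivalence = isEquivalence
            ; ∙-cong        = λ {x} {x′} {y} {y′} x≈x′ y≈y′ → begin
                x * y                     ≈⟨ *-def x y ⟩
                ∼ ((∼ x) + (∼ y))         ≈⟨ ∼-cong (∙-cong (∼-cong x≈x′) (∼-cong y≈y′)) ⟩
                ∼ ((∼ x′) + (∼ y′))       ≈⟨ *-def x′ y′ ⟨
                x′ * y′                   ∎
            }
          ; assoc = λ x y z → begin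
              (x * y) * z                       ≈⟨ *-def (x * y) z ⟩
              ∼ ((∼ (x * y)) + (∼ z))           ≈⟨ ∼-cong (∙-congʳ (∼* x y)) ⟩
              ∼ (((∼ x) + (∼ y)) + (∼ z))       ≈⟨ ∼-cong (assoc (∼ x) (∼ y) (∼ z)) ⟩
              ∼ ((∼ x) + ((∼ y) + (∼ z)))       ≈⟨ ∼-cong (∙-congˡ (∼* y z)) ⟨
              ∼ ((∼ x) + (∼ (y * z)))           ≈⟨ *-def x (y * z) ⟨
              x * (y * z)                       ∎
          }
        ; identity = *-identityˡ , λ x → trans (*-comm x u) (*-identityˡ x)
        }
      ; comm = *-comm
      }
    ; ∼-cong      = ∼-cong
    ; ∼-involutive = ∼-involutive
    ; u-zeroˡ     = λ x → begin
        e * x                 ≈⟨ *-def e x ⟩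
        ∼ ((∼ e) + (∼ x))     ≈⟨ ∼-cong (comm (∼ e) (∼ x)) ⟩
        ∼ ((∼ x) + (∼ e))     ≈⟨ ∼-cong (∼e-zeroʳ (∼ x)) ⟩
        ∼ (∼ e)               ≈⟨ ∼-involutive e ⟩
        e                     ∎
    ; ∼e-zeroʳ    = λ x → begin
        x * (∼ u)                 ≈⟨ *-def x (∼ u) ⟩
        ∼ ((∼ x) + (∼ (∼ u)))     ≈⟨ ∼-cong (∙-congˡ (∼-involutive u)) ⟩
        ∼ ((∼ x) + u)             ≈⟨ ∼-cong (comm (∼ x) u) ⟩
        ∼ (u + (∼ x))             ≈⟨ ∼-cong (u-zeroˡ (∼ x)) ⟩
        ∼ u                       ∎
    ; łukasiewicz = λ x y → begin
        (∼ ((∼ x) * y)) * y       ≈⟨ dual-join x y ⟩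
        ∼ ((∼ ((∼ (∼ x)) + (∼ y))) + (∼ y))   ≈⟨ ∼-cong (łukasiewicz (∼ x) (∼ y)) ⟩
        ∼ ((∼ ((∼ (∼ y)) + (∼ x))) + (∼ x))   ≈⟨ dual-join y x ⟨
        (∼ ((∼ y) * x)) * x       ∎
    }
    where
    open IsMVAlgebra mv
    open IsCommutativeMonoid isCommutativeMonoid
    open SetoidReasoning setoid

    ∼* : ∀ x y → (∼ (x * y)) ≈ ((∼ x) + (∼ y))
    ∼* x y = trans (∼-cong (*-def x y)) (∼-involutive _)

    *-comm : ∀ x y → (x * y) ≈ (y * x)
    *-comm x y = trans (*-def x y) (trans (∼-cong (comm (∼ x) (∼ y))) (sym (*-def y x)))

    -- Both elements are absorbing; `u + (∼ e)` equals each of them.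
    u≈∼e : u ≈ (∼ e)
    u≈∼e = trans (sym (u-zeroˡ (∼ e))) (∼e-zeroʳ u)

    *-identityˡ : ∀ x → (u * x) ≈ x
    *-identityˡ x = begin
      u * x                 ≈⟨ *-def u x ⟩
      ∼ ((∼ u) + (∼ x))     ≈⟨ ∼-cong (∙-congʳ (trans (∼-cong u≈∼e) (∼-involutive e))) ⟩
      ∼ (e + (∼ x))         ≈⟨ ∼-cong (identityˡ (∼ x)) ⟩
      ∼ (∼ x)               ≈⟨ ∼-involutive x ⟩
      x                     ∎

    dual-join : ∀ x y → ((∼ ((∼ x) * y)) * y) ≈ (∼ ((∼ ((∼ (∼ x)) + (∼ y))) + (∼ y)))
    dual-join x y = begin
      (∼ ((∼ x) * y)) * y                     ≈⟨ *-def _ y ⟩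
      ∼ ((∼ (∼ ((∼ x) * y))) + (∼ y))         ≈⟨ ∼-cong (∙-congʳ (∼-cong (∼* (∼ x) y))) ⟩
      ∼ ((∼ ((∼ (∼ x)) + (∼ y))) + (∼ y))     ∎

-- Transfer of the structure along heights.

module Rectangles (em : ExcludedMiddle 0ℓ) (ℝ : CompleteOrderedField) where
  open CompleteOrderedField ℝ hiding (zero)
  open UnitSquare ℝ
  open OrderedFieldProperties ℝ
  open Lebesgue em ℝ
  open TruncatedAddition ℝ
  open IntegerCoefficientSolver commutativeRing

  height : 𝓡⁰ → Carrier
  height (_ , a , _) = value a

  height≥0 : ∀ S → 0# ≤ height S
  height≥0 (_ , a , _) = proj₁ (proj₂ a)

  height≤1 : ∀ S → height S ≤ 1#
  height≤1 (_ , a , _) = proj₂ (proj₂ a)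

  -- Equality in `𝓡⁰` is extensional while the operations use the stored height. Together with
  -- `height-cong` this makes the height a faithful coordinate, in which all laws are checked.
  height-injective : ∀ S T → height S ≈ height T → S ≈ᴿ T
  height-injective (_ , a , S≐) (_ , b , T≐) a≈b =
    ≐-trans S≐ (≐-trans (≤.≤-respʳ-≈ a≈b , ≤.≤-respʳ-≈ (sym a≈b)) (≐-sym T≐))

  -- The inclusions are evaluated at points of the top edges, `(0ᴵ , a)` and `(0ᴵ , b)`.
  height-cong : ∀ S T → S ≈ᴿ T → height S ≈ height T
  height-cong (_ , a , S⊆ , ⊆S) (_ , b , T⊆ , ⊆T) (S⊆T , T⊆S) = ≤.antisym
    (T⊆ {0ᴵ , a} (S⊆T (⊆S ≤.refl))) (S⊆ {0ᴵ , b} (T⊆S (⊆T ≤.refl)))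

  height-⊕ : ∀ S T → height (S ⊕ T) ≈ height S ⊞ height T
  height-⊕ (_ , a , _) (_ , b , _) = μ-∪ a b

  height-∼ : ∀ S → height (∼ S) ≈ 1# - height S
  height-∼ (_ , a , _) = μ-∁R⁰ a

  height-⊙ : ∀ S T → height (S ⊙ T) ≈ 1# - ((1# - height S) ⊞ (1# - height T))
  height-⊙ (_ , a , _) (_ , b , _) = μ-∩ a b

  ⊕-comm : ∀ S T → S ⊕ T ≈ᴿ T ⊕ S
  ⊕-comm S T = height-injective (S ⊕ T) (T ⊕ S)
    (trans (height-⊕ S T) (trans (⊞-comm (height S) (height T)) (sym (height-⊕ T S))))

  ⊕-cong : ∀ S S′ T T′ → S ≈ᴿ S′ → T ≈ᴿ T′ → S ⊕ T ≈ᴿ S′ ⊕ T′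
  ⊕-cong S S′ T T′ S≈S′ T≈T′ = height-injective (S ⊕ T) (S′ ⊕ T′)
    (trans (height-⊕ S T) (trans (⊞-cong (height-cong S S′ S≈S′) (height-cong T T′ T≈T′)) (sym (height-⊕ S′ T′))))

  ⊕-assoc : ∀ S T V → (S ⊕ T) ⊕ V ≈ᴿ S ⊕ (T ⊕ V)
  ⊕-assoc S T V = height-injective ((S ⊕ T) ⊕ V) (S ⊕ (T ⊕ V))
    (trans (height-⊕ (S ⊕ T) V) (trans (⊞-cong (height-⊕ S T) refl)
    (trans (⊞-assoc (height≥0 S) (height≥0 V))
    (sym (trans (height-⊕ S (T ⊕ V)) (⊞-cong refl (height-⊕ T V)))))))

  ⊕-identityˡ : ∀ S → 𝟘 ⊕ S ≈ᴿ S
  ⊕-identityˡ S = height-injective (𝟘 ⊕ S) S (trans (height-⊕ 𝟘 S) (⊞-identityˡ (height≤1 S)))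

  ⊕-zeroˡ : ∀ S → 𝟙 ⊕ S ≈ᴿ 𝟙
  ⊕-zeroˡ S = height-injective (𝟙 ⊕ S) 𝟙 (trans (height-⊕ 𝟙 S) (⊞-zeroˡ (height≥0 S)))

  ∼-cong : ∀ S T → S ≈ᴿ T → ∼ S ≈ᴿ ∼ T
  ∼-cong S T S≈T = height-injective (∼ S) (∼ T)
    (trans (height-∼ S) (trans (+-congˡ (-‿cong (height-cong S T S≈T))) (sym (height-∼ T))))

  ∼-involutive : ∀ S → ∼ (∼ S) ≈ᴿ S
  ∼-involutive S = height-injective (∼ (∼ S)) S
    (trans (height-∼ (∼ S)) (trans (+-congˡ (-‿cong (height-∼ S)))
      (solve 1 (λ x → :1 :- (:1 :- x) := x) refl (height S))))

  ∼𝟘≈𝟙 : ∼ 𝟘 ≈ᴿ 𝟙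
  ∼𝟘≈𝟙 = height-injective (∼ 𝟘) 𝟙 (trans (height-∼ 𝟘) (solve 0 (:1 :- :0 := :1) refl))

  ⊕-zeroʳ-∼𝟘 : ∀ S → S ⊕ (∼ 𝟘) ≈ᴿ ∼ 𝟘
  ⊕-zeroʳ-∼𝟘 S = ≐-trans (⊕-comm S (∼ 𝟘)) (≐-trans (⊕-cong (∼ 𝟘) 𝟙 S S ∼𝟘≈𝟙 ≐-refl)
    (≐-trans (⊕-zeroˡ S) (≐-sym ∼𝟘≈𝟙)))

  height-join : ∀ S T → height ((∼ ((∼ S) ⊕ T)) ⊕ T) ≈ join (height S) (height T)
  height-join S T = trans (height-⊕ (∼ ((∼ S) ⊕ T)) T) (⊞-cong
    (trans (height-∼ ((∼ S) ⊕ T)) (+-congˡ (-‿cong (trans (height-⊕ (∼ S) T) (⊞-cong (height-∼ S) refl))))) refl)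

  ⊕-isMVAlgebra : IsMVAlgebra _≈ᴿ_ _⊕_ ∼_ 𝟘 𝟙
  ⊕-isMVAlgebra = record
    { isCommutativeMonoid = record
      { isMonoid = record
        { isSemigroup = record
          { isMagma = record
            { isEquivalence = record { refl = ≐-refl ; sym = ≐-sym ; trans = ≐-trans }
            ; ∙-cong        = λ {S} {S′} {T} {T′} → ⊕-cong S S′ T T′
            }
          ; assoc = ⊕-assoc
          }
        ; identity = ⊕-identityˡ , λ S → ≐-trans (⊕-comm S 𝟘) (⊕-identityˡ S)
        }
      ; comm = ⊕-comm
      }
    ; ∼-cong       = λ {S} {T} → ∼-cong S T
    ; ∼-involutive = ∼-involutive
    ; u-zeroˡ      = ⊕-zeroˡ
    ; ∼e-zeroʳ     = ⊕-zeroʳ-∼𝟘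
    ; łukasiewicz  = λ S T → height-injective ((∼ ((∼ S) ⊕ T)) ⊕ T) ((∼ ((∼ T) ⊕ S)) ⊕ S)
        (trans (height-join S T) (trans (join-comm (height≤1 S) (height≤1 T)) (sym (height-join T S))))
    }

  ⊙-isMVAlgebra : IsMVAlgebra _≈ᴿ_ _⊙_ ∼_ 𝟙 𝟘
  ⊙-isMVAlgebra = isMVAlgebra-dual ⊕-isMVAlgebra λ S T →
    height-injective (S ⊙ T) (∼ ((∼ S) ⊕ (∼ T))) (trans (height-⊙ S T)
      (sym (trans (height-∼ ((∼ S) ⊕ (∼ T)))
        (+-congˡ (-‿cong (trans (height-⊕ (∼ S) (∼ T)) (⊞-cong (height-∼ S) (height-∼ T))))))))

theorem5 : ExcludedMiddle 0ℓ → (ℝ : CompleteOrderedField) →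
    let open UnitSquare ℝ in
    (∀ a b → LebesgueMeasurable (R⁰ a ∪ R¹ b) ×
    LebesgueMeasurable (R⁰ a ∩ R¹ b) ×
    LebesgueMeasurable (∁ (R⁰ a))) ×
    (∀ a → ∼ R⁰[ a ] ≈ᴿ R⁰[ 1ᴵ- a ]) ×
    (proj₁ 𝟙 ≐ U) ×
    IsMVAlgebra _≈ᴿ_ _⊕_ ∼_ 𝟘 𝟙 ×
    IsMVAlgebra _≈ᴿ_ _⊙_ ∼_ 𝟙 𝟘
theorem5 em ℝ =
  (λ a b → measurable-∪ {R⁰ a} {R¹ b} (measurable-R⁰ a) (measurable-R¹ b)
         , measurable-∩ {R⁰ a} {R¹ b} (measurable-R⁰ a) (measurable-R¹ b)
         , measurable-∁ {R⁰ a} (measurable-R⁰ a)) ,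
  (λ a → height-injective (∼ R⁰[ a ]) R⁰[ 1ᴵ- a ] (height-∼ R⁰[ a ])) ,
  ((λ _ → _) , λ {p} _ → proj₂ (proj₂ (proj₂ p))) ,
  ⊕-isMVAlgebra ,
  ⊙-isMVAlgebra
  where
  open UnitSquare ℝ
  open Lebesgue em ℝ
  open Rectangles em ℝ
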